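{- Let $p$ be an odd prime, $x\in\mathbb Z_p$ and $x\not\equiv0\pmod p$. Then $$\sum_{k=0}^{\frac{p-1}2}\binom{2k}k^2\Big(\frac x4\Big)^{2k}\equiv\Big(\frac{ -x}p\Big)P_{\frac{p-1}2}\Big(\frac{x+x^{ -1}}2\Big)\pmod p.$$
   Context: $\mathbb Z_p$ denotes the set of rational numbers whose denominator (in lowest terms) is prime to $p$; congruences are in this ring. For $a\in\mathbb Z_p$, $\big(\frac ap\big)$ is the Legendre symbol of the residue of $a$ modulo $p$. $P_n(x)$ is the $n$-th Legendre polynomial, defined by $\frac1{\sqrt{1-2xt+t^2}}=\sum_{n\ge0}P_n(x)t^n$, equivalently $P_n(x)=\frac1{2^n}\sum_{k=0}^{[n/2]}\frac{(-1)^k(2n-2k)!}{k!(n-k)!(n-2k)!}x^{n-2k}$. -}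

module Defs where

open import Algebra.Bundles using (CommutativeRing)
open import Data.Bool using (if_then_else_)
open import Data.Fin using (Fin; toℕ; fromℕ<)
open import Data.Fin.Properties using (any?; toℕ-fromℕ<)
open import Data.Integer as ℤ using (ℤ; +_; -1ℤ; 0ℤ; 1ℤ)
open import Data.Integer.DivMod using (_/ℕ_; n%ℕd<d; a≡a%ℕn+[a/ℕn]*n)
import Data.Integer.Properties as ℤ
open import Data.Integer.Tactic.RingSolver using (solve-∀)
open import Data.Nat as ℕ using (ℕ; suc; NonZero)
open import Data.Nat.Coprimality using (Coprime; coprime-Bézout)
open import Data.Nat.Divisibility using (_∣_; _∣?_; divides; ∣-trans; ∣1⇒≡1)
open import Data.Nat.GCD using (gcd; module Bézout)
open import Data.Nat.Primality using (Prime; prime⇒nonZero)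
import Data.Nat.Properties as ℕ
open import Data.Product using (Σ-syntax; ∃-syntax; _,_; proj₁; proj₂)
open import Data.Rational as ℚ using (ℚ; 0ℚ; ½; ↥_; ↧_; ↧ₙ_; _+_; _*_; _-_; -_; _/_; toℚᵘ)
import Data.Rational.Properties as ℚ
open import Data.Rational.Unnormalised as ℚᵘ using (mkℚᵘ; *≡*)
import Data.Rational.Unnormalised.Properties as ℚᵘ
open import Relation.Binary.PropositionalEquality
open import Relation.Nullary using (¬_; Dec)
open import Relation.Nullary.Decidable using (⌊_⌋)

open import Algebra.Properties.Semiring.Exp
  (CommutativeRing.semiring ℚ.+-*-commutativeRing) public using (_^_)
open import Algebra.Properties.CommutativeMonoid.Sum
  ℚ.+-0-commutativeMonoid public using (sum-syntax)

fromℤ : ℤ → ℚ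
fromℤ i = i / 1

fromℕ : ℕ → ℚ
fromℕ n = fromℤ (+ n)

-- Read "a lies in ℤ₍ p ₎", the ring of rationals with denominator prime to p;
-- ↧ₙ is the denominator in lowest terms.

infix 4 _∈ℤ₍_₎

_∈ℤ₍_₎ : ℚ → ℕ → Set
a ∈ℤ₍ p ₎ = Coprime (↧ₙ a) p

-- Congruence modulo the ideal p ℤ₍ p ₎; both sides must lie in ℤ₍ p ₎.

infix 4 _≡_[mod_]

record _≡_[mod_] (a b : ℚ) (p : ℕ) : Set where
  field
    left∈      : a ∈ℤ₍ p ₎
    right∈     : b ∈ℤ₍ p ₎
    quotient   : ℚ
    quotient∈  : quotient ∈ℤ₍ p ₎
    difference : a - b ≡ fromℕ p * quotient

/∈ : ∀ {p} i d .{{_ : NonZero d}} → Coprime d p → i / d ∈ℤ₍ p ₎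
/∈ i d d⊥p (e∣↧ , e∣p) = d⊥p (∣-trans e∣↧ ↧∣d , e∣p)
  where
  g : ℕ
  g = gcd ℤ.∣ i ∣ d
  ↧∣d : ↧ₙ (i / d) ∣ d
  ↧∣d = divides g (ℤ.+-injective (begin
    + d                          ≡⟨ ℚ.↧-/ i d ⟨
    ↧ (i / d) ℤ.* + g            ≡⟨ ℤ.*-comm (↧ (i / d)) (+ g) ⟩
    + g ℤ.* ↧ (i / d)            ≡⟨ ℤ.pos-* g (↧ₙ (i / d)) ⟨
    + (g ℕ.* ↧ₙ (i / d))         ∎))
    where open ≡-Reasoning

fromℤ∈ : ∀ {p} i → fromℤ i ∈ℤ₍ p ₎
fromℤ∈ i = /∈ i 1 (λ { (e∣1 , _) → ∣1⇒≡1 e∣1 })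

neg∈ : ∀ {p} a → a ∈ℤ₍ p ₎ → - a ∈ℤ₍ p ₎
neg∈ {p} a a∈ = subst (λ d → Coprime d p) (sym (ℤ.+-injective (ℚ.↧-neg a))) a∈

≢0⇒nonZero : ∀ {p x} → ¬ (x ≡ 0ℚ [mod p ]) → ℚ.NonZero x
≢0⇒nonZero {p} {x} x≢0 = ℚ.≢-nonZero {x} λ { refl → x≢0 (record
  { left∈      = fromℤ∈ 0ℤ
  ; right∈     = fromℤ∈ 0ℤ
  ; quotient   = 0ℚ
  ; quotient∈  = fromℤ∈ 0ℤ
  ; difference = sym (ℚ.*-zeroʳ (fromℕ p))
  }) }

private
  inverse : ∀ {d p} → Coprime d p → Σ[ u ∈ ℤ ] Σ[ w ∈ ℤ ] + d ℤ.* u ≡ 1ℤ ℤ.+ + p ℤ.* w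
  inverse {d} {p} c with coprime-Bézout c
  ... | Bézout.+- x y eq = + x , + y , (begin
    + d ℤ.* + x           ≡⟨ ℤ.*-comm (+ d) (+ x) ⟩
    + x ℤ.* + d           ≡⟨ ℤ.pos-* x d ⟨
    + (x ℕ.* d)           ≡⟨ cong +_ eq ⟨
    1ℤ ℤ.+ + (y ℕ.* p)    ≡⟨ cong (ℤ._+_ 1ℤ) (ℤ.pos-* y p) ⟩
    1ℤ ℤ.+ + y ℤ.* + p    ≡⟨ cong (ℤ._+_ 1ℤ) (ℤ.*-comm (+ y) (+ p)) ⟩
    1ℤ ℤ.+ + p ℤ.* + y    ∎)
    where open ≡-Reasoning
  ... | Bézout.-+ x y eq = ℤ.- + x , ℤ.- + y , (begin
    + d ℤ.* (ℤ.- + x)                             ≡⟨ lem₁ (+ d) (+ x) ⟩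
    1ℤ ℤ.- (1ℤ ℤ.+ + x ℤ.* + d)                   ≡⟨ cong (λ t → 1ℤ ℤ.- (1ℤ ℤ.+ t)) (ℤ.pos-* x d) ⟨
    1ℤ ℤ.- + (1 ℕ.+ x ℕ.* d)                      ≡⟨ cong (λ t → 1ℤ ℤ.- + t) eq ⟩
    1ℤ ℤ.- + (y ℕ.* p)                            ≡⟨ cong (λ t → 1ℤ ℤ.- t) (ℤ.pos-* y p) ⟩
    1ℤ ℤ.- + y ℤ.* + p                            ≡⟨ lem₂ (+ y) (+ p) ⟩
    1ℤ ℤ.+ + p ℤ.* (ℤ.- + y)                      ∎)
    where
    open ≡-Reasoning
    lem₁ : ∀ d x → d ℤ.* (ℤ.- x) ≡ 1ℤ ℤ.- (1ℤ ℤ.+ x ℤ.* d)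
    lem₁ = solve-∀
    lem₂ : ∀ y p → 1ℤ ℤ.- y ℤ.* p ≡ 1ℤ ℤ.+ p ℤ.* (ℤ.- y)
    lem₂ = solve-∀

  difference≃ : ∀ a {r p z} → ↥ a ℤ.- r ℤ.* ↧ a ≡ p ℤ.* z →
    toℚᵘ a ℚᵘ.- mkℚᵘ r 0 ℚᵘ.≃ mkℚᵘ p 0 ℚᵘ.* mkℚᵘ z (ℚ.ℚ.denominator-1 a)
  difference≃ (ℚ.mkℚ n d-1 _) {r} {p} {z} eq = *≡* (begin
    (n ℤ.* 1ℤ ℤ.+ (ℤ.- r) ℤ.* d) ℤ.* + (1 ℕ.* suc d-1)
      ≡⟨ cong₂ ℤ._*_ (lem n r d) (cong +_ (trans (ℕ.*-identityˡ (suc d-1)) (sym (ℕ.*-identityʳ (suc d-1))))) ⟩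
    (n ℤ.- r ℤ.* d) ℤ.* + (suc d-1 ℕ.* 1)
      ≡⟨ cong (ℤ._* + (suc d-1 ℕ.* 1)) eq ⟩
    p ℤ.* z ℤ.* + (suc d-1 ℕ.* 1) ∎)
    where
    open ≡-Reasoning
    d = + suc d-1
    lem : ∀ n r d → n ℤ.* 1ℤ ℤ.+ (ℤ.- r) ℤ.* d ≡ n ℤ.- r ℤ.* d
    lem = solve-∀

residue : ∀ {p} → Prime p → ∀ a → a ∈ℤ₍ p ₎ → Σ[ r ∈ Fin p ] a ≡ fromℕ (toℕ r) [mod p ]
residue {p} pr a a∈ = r , record
  { left∈      = a∈
  ; right∈     = fromℤ∈ (+ toℕ r)
  ; quotient   = z / d
  ; quotient∈  = /∈ z d a∈
  ; difference = ℚ.toℚᵘ-injective diff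
  }
  where
  instance
    _ : NonZero p
    _ = prime⇒nonZero pr
  n u w q z : ℤ
  d : ℕ
  n = ↥ a
  d = ↧ₙ a
  u = proj₁ (inverse a∈)
  w = proj₁ (proj₂ (inverse a∈))
  q = (n ℤ.* u) /ℕ p
  z = q ℤ.* + d ℤ.- n ℤ.* w
  r : Fin p
  r = fromℕ< (n%ℕd<d (n ℤ.* u) p)

  nu : n ℤ.* u ≡ + toℕ r ℤ.+ q ℤ.* + p
  nu = trans (a≡a%ℕn+[a/ℕn]*n (n ℤ.* u) p)
    (cong (λ t → + t ℤ.+ q ℤ.* + p) (sym (toℕ-fromℕ< (n%ℕd<d (n ℤ.* u) p))))

  key : n ℤ.- + toℕ r ℤ.* + d ≡ + p ℤ.* z
  key = begin
    n ℤ.- + toℕ r ℤ.* + d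
      ≡⟨ lem₁ n (+ toℕ r) (+ d) (q ℤ.* + p) ⟩
    n ℤ.- (+ toℕ r ℤ.+ q ℤ.* + p) ℤ.* + d ℤ.+ q ℤ.* + p ℤ.* + d
      ≡⟨ cong (λ t → n ℤ.- t ℤ.* + d ℤ.+ q ℤ.* + p ℤ.* + d) nu ⟨
    n ℤ.- n ℤ.* u ℤ.* + d ℤ.+ q ℤ.* + p ℤ.* + d
      ≡⟨ lem₂ n u (+ d) (q ℤ.* + p ℤ.* + d) ⟩
    n ℤ.- n ℤ.* (+ d ℤ.* u) ℤ.+ q ℤ.* + p ℤ.* + d
      ≡⟨ cong (λ t → n ℤ.- n ℤ.* t ℤ.+ q ℤ.* + p ℤ.* + d) (proj₂ (proj₂ (inverse a∈))) ⟩
    n ℤ.- n ℤ.* (1ℤ ℤ.+ + p ℤ.* w) ℤ.+ q ℤ.* + p ℤ.* + d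
      ≡⟨ lem₃ n (+ p) w q (+ d) ⟩
    + p ℤ.* z ∎
    where
    open ≡-Reasoning
    lem₁ : ∀ n r d s → n ℤ.- r ℤ.* d ≡ n ℤ.- (r ℤ.+ s) ℤ.* d ℤ.+ s ℤ.* d
    lem₁ = solve-∀
    lem₂ : ∀ n u d s → n ℤ.- n ℤ.* u ℤ.* d ℤ.+ s ≡ n ℤ.- n ℤ.* (d ℤ.* u) ℤ.+ s
    lem₂ = solve-∀
    lem₃ : ∀ n p w q d → n ℤ.- n ℤ.* (1ℤ ℤ.+ p ℤ.* w) ℤ.+ q ℤ.* p ℤ.* d ≡ p ℤ.* (q ℤ.* d ℤ.- n ℤ.* w)
    lem₃ = solve-∀

  diff : toℚᵘ (a - fromℕ (toℕ r)) ℚᵘ.≃ toℚᵘ (fromℕ p * (z / d))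
  diff = begin
    toℚᵘ (a - fromℕ (toℕ r))
      ≈⟨ ℚ.toℚᵘ-homo-+ a (- fromℕ (toℕ r)) ⟩
    toℚᵘ a ℚᵘ.+ toℚᵘ (- fromℕ (toℕ r))
      ≈⟨ ℚᵘ.+-congʳ (toℚᵘ a) (ℚ.toℚᵘ-homo‿- (fromℕ (toℕ r))) ⟩
    toℚᵘ a ℚᵘ.- toℚᵘ (fromℕ (toℕ r))
      ≈⟨ ℚᵘ.+-congʳ (toℚᵘ a) (ℚᵘ.-‿cong (ℚ.toℚᵘ-fromℚᵘ (mkℚᵘ (+ toℕ r) 0))) ⟩
    toℚᵘ a ℚᵘ.- mkℚᵘ (+ toℕ r) 0
      ≈⟨ difference≃ a {+ toℕ r} {+ p} {z} key ⟩
    mkℚᵘ (+ p) 0 ℚᵘ.* mkℚᵘ z (ℚ.ℚ.denominator-1 a)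
      ≈⟨ ℚᵘ.*-cong (ℚ.toℚᵘ-fromℚᵘ (mkℚᵘ (+ p) 0)) (ℚ.toℚᵘ-fromℚᵘ (mkℚᵘ z (ℚ.ℚ.denominator-1 a))) ⟨
    toℚᵘ (fromℕ p) ℚᵘ.* toℚᵘ (z / d)
      ≈⟨ ℚ.toℚᵘ-homo-* (fromℕ p) (z / d) ⟨
    toℚᵘ (fromℕ p * (z / d)) ∎
    where
    open ℚᵘ.≃-Reasoning

-- y runs over representatives of the classes modulo p; ∣ y² - r ∣ is the
-- distance in ℕ, so the condition is y² ≡ r (mod p).
QuadraticResidue : ∀ {p} → Fin p → Set
QuadraticResidue {p} r = ∃[ y ] p ∣ ℕ.∣ toℕ {p} y ℕ.* toℕ y - toℕ r ∣

quadraticResidue? : ∀ {p} (r : Fin p) → Dec (QuadraticResidue r)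
quadraticResidue? {p} r = any? λ y → p ∣? _

legendre : ∀ {p} → Fin p → ℤ
legendre r =
  if ⌊ toℕ r ℕ.≟ 0 ⌋ then 0ℤ else
  if ⌊ quadraticResidue? r ⌋ then 1ℤ else -1ℤ

legendreSymbol : ∀ {p} → Prime p → ∀ a → a ∈ℤ₍ p ₎ → ℤ
legendreSymbol pr a a∈ = legendre (proj₁ (residue pr a a∈))

-- Pₙ(x) = 2⁻ⁿ Σ_{k ≤ n/2} (-1)ᵏ (2n-2k)! / (k! (n-k)! (n-2k)!) xⁿ⁻²ᵏ; the
-- truncated subtractions are exact because 2k ≤ n in this range.
legendreCoeff : ℕ → ℕ → ℚ
legendreCoeff n k = ((-1ℤ ℤ.^ k) ℤ.* + ((2 ℕ.* n ℕ.∸ 2 ℕ.* k) ℕ.!)) / (k ℕ.! ℕ.* (n ℕ.∸ k) ℕ.! ℕ.* (n ℕ.∸ 2 ℕ.* k) ℕ.!)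
  where instance
    _ = ℕ.m*n≢0 (k ℕ.! ℕ.* (n ℕ.∸ k) ℕ.!) ((n ℕ.∸ 2 ℕ.* k) ℕ.!)
          {{k ℕ.!* (n ℕ.∸ k) !≢0}} {{(n ℕ.∸ 2 ℕ.* k) ℕ.!≢0}}

legendreP : ℕ → ℚ → ℚ
legendreP n x = ½ ^ n * (∑[ k < suc (n ℕ./ 2) ] (legendreCoeff n (toℕ k) * x ^ (n ℕ.∸ 2 ℕ.* toℕ k)))

-- Put p = 2h + 1. Since -1/2 ≡ h, one has C(2m,m) ≡ (-4)ᵐ C(h,m) (mod p) for
-- m ≤ h, so the left-hand side is ≡ Σ C(h,k)² x²ᵏ. The coefficients of P_h are
-- (-1)ᵏ C(2m,m) C(m,k) with m = h - k, whence, with w = x + y and xy = 1,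
--   P_h(w/2) ≡ (-1)ʰ Σ C(h,k) C(h-k,k) wʰ⁻²ᵏ
--            = (-1)ʰ [tʰ] (1 + wt + t²)ʰ = (-1)ʰ [tʰ] (1 + xt)ʰ (1 + yt)ʰ
--            = (-1)ʰ Σ C(h,j)² xʲ yʰ⁻ʲ,
-- and Euler's criterion turns the Legendre symbol into (-x)ʰ.

module Submission where

open import Defs
open import Algebra.Bundles using (CommutativeRing)
open import Data.Bool using (if_then_else_)
open import Data.Fin as Fin using (Fin; toℕ; zero; suc; inject₁; fromℕ<)
import Data.Fin.Properties as Fin
open import Data.Integer as ℤ using (ℤ; +_; 0ℤ; 1ℤ; -1ℤ)
import Data.Integer.Divisibility.Signed as ℤ∣
import Data.Integer.Properties as ℤ
import Data.Integer.Tactic.RingSolver as ℤ-solver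
open import Data.Nat as ℕ using (ℕ; zero; suc; z≤n; s≤s; _!; NonZero)
open import Data.Nat.Combinatorics
open import Data.Nat.Coprimality using (Coprime; coprime-divisor)
import Data.Nat.DivMod as ℕ
open import Data.Nat.Divisibility as ℕ∣ using (_∣_)
open import Data.Nat.Primality using (Prime; euclidsLemma; prime⇒irreducible; prime⇒nonTrivial; prime⇒nonZero)
import Data.Nat.Properties as ℕ
import Data.Nat.Tactic.RingSolver as ℕ-solver
open import Data.Product using (Σ-syntax; _,_; proj₁)
open import Data.Rational as ℚ using (ℚ; mkℚ; 0ℚ; 1ℚ; ½; ↥_; ↧ₙ_; _+_; _*_; -_; _-_; _/_; 1/_)
import Data.Rational.Properties as ℚ
open import Data.Rational.Unnormalised as ℚᵘ using (mkℚᵘ; *≡*)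
import Data.Rational.Unnormalised.Properties as ℚᵘ
open import Data.Sum as Sum using (_⊎_; inj₁; inj₂)
open import Data.Vec using (Vec; []; _∷_; replicate)
open import Function using (id; _∘_)
open import Relation.Binary.PropositionalEquality
open import Relation.Nullary using (¬_; Dec; yes; no; contradiction)
open import Relation.Nullary.Decidable using (⌊_⌋; dec⇒maybe)
open import Tactic.RingSolver using (solve-∀)
open import Tactic.RingSolver.Core.AlmostCommutativeRing using (AlmostCommutativeRing; fromCommutativeRing)

open import Algebra.Properties.CommutativeSemiring.Exp (CommutativeRing.commutativeSemiring ℚ.+-*-commutativeRing)
  using (^-distrib-*; ^-homo-*; ^-assocʳ)
open import Algebra.Properties.Group (CommutativeRing.+-group ℚ.+-*-commutativeRing)
  using (inverseʳ-unique)
open import Algebra.Properties.Semiring.Sum (CommutativeRing.semiring ℚ.+-*-commutativeRing)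
  using (sum-cong-≗; ∑-distrib-+; *-distribˡ-sum)
import Algebra.Properties.CommutativeSemiring.Binomial ℤ.+-*-commutativeSemiring as Binomial
open import Algebra.Properties.Semiring.Exp ℤ.+-*-semiring using () renaming (_^_ to _^ᴿ_)
open import Algebra.Properties.Semiring.Mult ℤ.+-*-semiring using (_×_)
open import Algebra.Properties.Semiring.Sum ℤ.+-*-semiring using (sum; sum-init-last)

open _≡_[mod_]

-- The two sides are reduced modulo p in only two places: in the central binomial coefficients and
-- in Euler's criterion. The trinomial identity between them is exact over ℚ. For it, a polynomial
-- in t is treated not as a list of coefficients but as the operator on sequences that multiplies a
-- power series by it. Both expansions of (1 + wt + t²)ʰ then come from one binomial theorem for
-- commuting operators, and extracting [tʰ] is evaluation at h. Euler's criterion rests on Fermat's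
-- little theorem and on Lagrange's bound for the roots of a monic integer polynomial modulo p.

ℚ-ring : AlmostCommutativeRing _ _
ℚ-ring = fromCommutativeRing ℚ.+-*-commutativeRing (λ q → dec⇒maybe (0ℚ ℚ.≟ q))

-- The embedding of ℤ in ℚ

fromℤ-+ : ∀ i j → fromℤ (i ℤ.+ j) ≡ fromℤ i + fromℤ j
fromℤ-+ i j = ℚ.toℚᵘ-injective (begin
  ℚ.toℚᵘ (fromℤ (i ℤ.+ j))                    ≈⟨ ℚ.toℚᵘ-fromℚᵘ (mkℚᵘ (i ℤ.+ j) 0) ⟩
  mkℚᵘ (i ℤ.+ j) 0                            ≡⟨ cong₂ (λ a b → mkℚᵘ (a ℤ.+ b) 0) (ℤ.*-identityʳ i) (ℤ.*-identityʳ j) ⟨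
  mkℚᵘ i 0 ℚᵘ.+ mkℚᵘ j 0                      ≈⟨ ℚᵘ.+-cong (ℚ.toℚᵘ-fromℚᵘ (mkℚᵘ i 0)) (ℚ.toℚᵘ-fromℚᵘ (mkℚᵘ j 0)) ⟨
  ℚ.toℚᵘ (fromℤ i) ℚᵘ.+ ℚ.toℚᵘ (fromℤ j)      ≈⟨ ℚ.toℚᵘ-homo-+ (fromℤ i) (fromℤ j) ⟨
  ℚ.toℚᵘ (fromℤ i + fromℤ j)                  ∎)
  where
  open ℚᵘ.≃-Reasoning

fromℤ-* : ∀ i j → fromℤ (i ℤ.* j) ≡ fromℤ i * fromℤ j
fromℤ-* i j = ℚ.toℚᵘ-injective (begin
  ℚ.toℚᵘ (fromℤ (i ℤ.* j))                    ≈⟨ ℚ.toℚᵘ-fromℚᵘ (mkℚᵘ (i ℤ.* j) 0) ⟩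
  mkℚᵘ i 0 ℚᵘ.* mkℚᵘ j 0                      ≈⟨ ℚᵘ.*-cong (ℚ.toℚᵘ-fromℚᵘ (mkℚᵘ i 0)) (ℚ.toℚᵘ-fromℚᵘ (mkℚᵘ j 0)) ⟨
  ℚ.toℚᵘ (fromℤ i) ℚᵘ.* ℚ.toℚᵘ (fromℤ j)      ≈⟨ ℚ.toℚᵘ-homo-* (fromℤ i) (fromℤ j) ⟨
  ℚ.toℚᵘ (fromℤ i * fromℤ j)                  ∎)
  where open ℚᵘ.≃-Reasoning

-- Finite sums and sums weighted by binomial coefficients

sum-cong-< : ∀ n {f g : ℕ → ℚ} → (∀ {k} → k ℕ.< n → f k ≡ g k) →
  ∑[ k < n ] f (toℕ k) ≡ ∑[ k < n ] g (toℕ k)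
sum-cong-< n f≡g = sum-cong-≗ {n} (λ k → f≡g (Fin.toℕ<n k))

sum-truncate : ∀ {m n} → m ℕ.≤ n → (f : ℕ → ℚ) → (∀ {k} → m ℕ.≤ k → f k ≡ 0ℚ) →
  ∑[ k < n ] f (toℕ k) ≡ ∑[ k < m ] f (toℕ k)
sum-truncate {n = zero}  z≤n f f≡0 = refl
sum-truncate {n = suc n} z≤n f f≡0 =
  trans (cong₂ _+_ (f≡0 z≤n) (sum-truncate {n = n} z≤n (f ∘ suc) (λ _ → f≡0 z≤n))) (ℚ.+-identityˡ 0ℚ)
sum-truncate (s≤s m≤n) f f≡0 = cong (λ t → f 0 + t) (sum-truncate m≤n (f ∘ suc) (f≡0 ∘ s≤s))

binomialSum : ℕ → (ℕ → ℚ) → ℚ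
binomialSum n f = ∑[ k < suc n ] (fromℕ (n C toℕ k) * f (toℕ k))

binomialSum-cong : ∀ n {f g} → (∀ {k} → k ℕ.≤ n → f k ≡ g k) → binomialSum n f ≡ binomialSum n g
binomialSum-cong n f≡g = sum-cong-< (suc n) λ {k} k≤n → cong (fromℕ (n C k) *_) (f≡g (ℕ.≤-pred k≤n))

binomialSum-+ : ∀ n f g → binomialSum n (λ k → f k + g k) ≡ binomialSum n f + binomialSum n g
binomialSum-+ n f g = trans
  (sum-cong-≗ {suc n} (λ k → ℚ.*-distribˡ-+ (fromℕ (n C toℕ k)) (f (toℕ k)) (g (toℕ k))))
  (∑-distrib-+ {suc n} (λ k → fromℕ (n C toℕ k) * f (toℕ k)) (λ k → fromℕ (n C toℕ k) * g (toℕ k)))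

fromℕ-C-suc : ∀ n k → fromℕ (suc n C suc k) ≡ fromℕ (n C k) + fromℕ (n C suc k)
fromℕ-C-suc n k = trans (cong fromℕ (sym (nCk+nC[k+1]≡[n+1]C[k+1] n k))) (fromℤ-+ (+ (n C k)) (+ (n C suc k)))

-- Pascal's rule under the sum. It is the induction step of the binomial theorem for operators,
-- where `f k` takes the place of aⁿ⁻ᵏbᵏ.
binomialSum-suc : ∀ n f → binomialSum (suc n) f ≡ binomialSum n f + binomialSum n (f ∘ suc)
binomialSum-suc n f = begin
  f₀ + ∑[ k < suc n ] (fromℕ (suc n C suc (toℕ k)) * f (suc (toℕ k)))
    ≡⟨ cong (λ t → f₀ + t) (sum-cong-≗ {suc n} λ k → trans
         (cong (_* f (suc (toℕ k))) (fromℕ-C-suc n (toℕ k)))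
         (ℚ.*-distribʳ-+ (f (suc (toℕ k))) (fromℕ (n C toℕ k)) (fromℕ (n C suc (toℕ k))))) ⟩
  f₀ + ∑[ k < suc n ] (fromℕ (n C toℕ k) * f (suc (toℕ k)) + g (toℕ k))
    ≡⟨ cong (λ t → f₀ + t) (∑-distrib-+ {suc n} (λ k → fromℕ (n C toℕ k) * f (suc (toℕ k))) (λ k → g (toℕ k))) ⟩
  f₀ + (binomialSum n (f ∘ suc) + ∑[ k < suc n ] g (toℕ k))
    -- The top term of the second sum carries `n C suc n`, which is 0, so that sum loses its last
    -- index and can be joined with `f₀`.
    ≡⟨ cong (λ t → f₀ + (binomialSum n (f ∘ suc) + t)) (sum-truncate (ℕ.n≤1+n n) g λ {k} n≤k →
         trans (cong (λ c → fromℕ c * f (suc k)) (k>n⇒nCk≡0 (s≤s n≤k))) (ℚ.*-zeroˡ (f (suc k)))) ⟩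
  f₀ + (binomialSum n (f ∘ suc) + ∑[ k < n ] g (toℕ k))
    ≡⟨ rearrange f₀ _ _ ⟩
  (f₀ + ∑[ k < n ] g (toℕ k)) + binomialSum n (f ∘ suc) ∎
  where
  open ≡-Reasoning
  f₀ = fromℕ (suc n C 0) * f 0
  g : ℕ → ℚ
  g k = fromℕ (n C suc k) * f (suc k)
  rearrange : ∀ a b c → a + (b + c) ≡ (a + c) + b
  rearrange = solve-∀ ℚ-ring

-- Central trinomial coefficients

Sequence : Set
Sequence = ℕ → ℚ

Operator : Set
Operator = Sequence → Sequence

infixl 6 _⊕_
_⊕_ : Sequence → Sequence → Sequence
(f ⊕ g) i = f i + g i

infixr 8 _↑_
-- The new factor is applied innermost, so inductions on the exponent keep the outer power and vary
-- the sequence.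
_↑_ : Operator → ℕ → Operator
(A ↑ zero)  f = f
(A ↑ suc n) f = (A ↑ n) (A f)

-- Sequences are functions and are compared pointwise, so respect for `_≗_` has to be carried along
-- with additivity.
record Additive (A : Operator) : Set where
  field
    cong-≗ : ∀ {f g} → f ≗ g → A f ≗ A g
    homo-⊕ : ∀ f g → A (f ⊕ g) ≗ A f ⊕ A g

open Additive

Commute : Operator → Operator → Set
Commute A B = ∀ f → A (B f) ≗ B (A f)

id-additive : Additive id
id-additive = record { cong-≗ = id ; homo-⊕ = λ _ _ _ → refl }

∘-additive : ∀ {A B} → Additive A → Additive B → Additive (A ∘ B)
∘-additive A⁺ B⁺ = record
  { cong-≗ = cong-≗ A⁺ ∘ cong-≗ B⁺
  ; homo-⊕ = λ f g i → trans (cong-≗ A⁺ (homo-⊕ B⁺ f g) i) (homo-⊕ A⁺ _ _ i)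
  }

↑-additive : ∀ {A} → Additive A → ∀ n → Additive (A ↑ n)
↑-additive A⁺ zero    = id-additive
↑-additive A⁺ (suc n) = ∘-additive (↑-additive A⁺ n) A⁺

↑-commute : ∀ {A B} → Additive A → Commute A B → ∀ n → Commute (A ↑ n) B
↑-commute A⁺ AB zero    f i = refl
↑-commute A⁺ AB (suc n) f i =
  trans (cong-≗ (↑-additive A⁺ n) (AB f) i) (↑-commute A⁺ AB n _ i)

-- Moving one `A` past Bⁿ splits off a factor `A ∘ B`. The composite is named `C` up to pointwise
-- equality, so that a product of two linear factors can be identified with a trinomial.
↑-∘ : ∀ {A B C} → Additive A → Additive B → Commute A B → (∀ f → A (B f) ≗ C f) →
  ∀ n f → (A ↑ n) ((B ↑ n) f) ≗ (C ↑ n) f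
↑-∘ A⁺ B⁺ AB AB≗C zero    f i = refl
↑-∘ {A} {B} {C} A⁺ B⁺ AB AB≗C (suc n) f i = begin
  (A ↑ n) (A ((B ↑ n) (B f))) i ≡⟨ cong-≗ (↑-additive A⁺ n) (λ j → sym (↑-commute B⁺ (λ g k → sym (AB g k)) n (B f) j)) i ⟩
  (A ↑ n) ((B ↑ n) (A (B f))) i ≡⟨ cong-≗ (∘-additive (↑-additive A⁺ n) (↑-additive B⁺ n)) (AB≗C f) i ⟩
  (A ↑ n) ((B ↑ n) (C f)) i     ≡⟨ ↑-∘ A⁺ B⁺ AB AB≗C n (C f) i ⟩
  (C ↑ n) (C f) i               ∎
  where open ≡-Reasoning

-- The binomial theorem for commuting operators. The innermost `T` is split into its two summands,
-- and the resulting `B` is carried out past the power of `A`; Pascal's rule then reassembles the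
-- two sums.
↑-binomial : ∀ {A B T} → Additive A → Additive B → Commute A B → (∀ f → T f ≗ A f ⊕ B f) →
  ∀ n f i → (T ↑ n) f i ≡ binomialSum n (λ k → (B ↑ k) ((A ↑ (n ℕ.∸ k)) f) i)
↑-binomial A⁺ B⁺ AB T≗A⊕B zero f i =
  sym (trans (ℚ.+-identityʳ _) (ℚ.*-identityˡ (f i)))
↑-binomial {A} {B} {T} A⁺ B⁺ AB T≗A⊕B (suc n) f i = begin
  (T ↑ n) (T f) i
    ≡⟨ ↑-binomial A⁺ B⁺ AB T≗A⊕B n (T f) i ⟩
  binomialSum n (λ k → (B ↑ k) ((A ↑ (n ℕ.∸ k)) (T f)) i)
    ≡⟨ binomialSum-cong n (λ {k} k≤n → split k k≤n) ⟩
  binomialSum n (λ k → g k + g (suc k))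
    ≡⟨ binomialSum-+ n g (g ∘ suc) ⟩
  binomialSum n g + binomialSum n (g ∘ suc)
    ≡⟨ binomialSum-suc n g ⟨
  binomialSum (suc n) g ∎
  where
  open ≡-Reasoning
  g : ℕ → ℚ
  g k = (B ↑ k) ((A ↑ (suc n ℕ.∸ k)) f) i
  split : ∀ k → k ℕ.≤ n → (B ↑ k) ((A ↑ (n ℕ.∸ k)) (T f)) i ≡ g k + g (suc k)
  split k k≤n = begin
    (B ↑ k) ((A ↑ m) (T f)) i
      ≡⟨ cong-≗ (∘-additive Bᵏ⁺ Aᵐ⁺) (T≗A⊕B f) i ⟩
    (B ↑ k) ((A ↑ m) (A f ⊕ B f)) i
      ≡⟨ homo-⊕ (∘-additive Bᵏ⁺ Aᵐ⁺) (A f) (B f) i ⟩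
    (B ↑ k) ((A ↑ suc m) f) i + (B ↑ k) ((A ↑ m) (B f)) i
      ≡⟨ cong₂ _+_ (cong (λ l → (B ↑ k) ((A ↑ l) f) i) (sym (ℕ.+-∸-assoc 1 k≤n)))
                   (cong-≗ Bᵏ⁺ (↑-commute A⁺ AB m f) i) ⟩
    g k + g (suc k) ∎
    where
    m = n ℕ.∸ k
    Bᵏ⁺ = ↑-additive B⁺ k
    Aᵐ⁺ = ↑-additive A⁺ m

-- A sequence f stands for the power series Σ fᵢ tⁱ, and shift for
-- multiplication by t.
shift : Operator
shift f zero    = 0ℚ
shift f (suc i) = f i

-- The power series 1. Applying an operator to it reads off the polynomial by which the operator
-- multiplies.
δ : Sequence
δ zero    = 1ℚ
δ (suc _) = 0ℚ

[1+_t] : ℚ → Operator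
[1+ x t] f i = f i + x * shift f i

[1+_t+t²] : ℚ → Operator
[1+ w t+t²] f i = [1+ w t] f i + shift (shift f) i

shift-additive : Additive shift
shift-additive = record
  { cong-≗ = λ { f≗g zero → refl ; f≗g (suc i) → f≗g i }
  ; homo-⊕ = λ { f g zero → refl ; f g (suc i) → refl }
  }

scale : ℚ → Operator
scale x f i = x * f i

scale-additive : ∀ x → Additive (scale x)
scale-additive x = record
  { cong-≗ = λ f≗g i → cong (x *_) (f≗g i)
  ; homo-⊕ = λ f g i → ℚ.*-distribˡ-+ x (f i) (g i)
  }

⊕-additive : ∀ {A B} → Additive A → Additive B → Additive (λ f → A f ⊕ B f)
⊕-additive {A} {B} A⁺ B⁺ = record
  { cong-≗ = λ f≗g i → cong₂ _+_ (cong-≗ A⁺ f≗g i) (cong-≗ B⁺ f≗g i)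
  ; homo-⊕ = λ f g i → trans (cong₂ _+_ (homo-⊕ A⁺ f g i) (homo-⊕ B⁺ f g i)) (interchange (A f i) (A g i) (B f i) (B g i))
  }
  where
  interchange : ∀ a b c d → (a + b) + (c + d) ≡ (a + c) + (b + d)
  interchange = solve-∀ ℚ-ring

xt-additive : ∀ x → Additive (scale x ∘ shift)
xt-additive x = ∘-additive (scale-additive x) shift-additive

[1+xt]-additive : ∀ x → Additive [1+ x t]
[1+xt]-additive x = ⊕-additive id-additive (xt-additive x)

shift-[1+xt] : ∀ x → Commute [1+ x t] shift
shift-[1+xt] x f zero    = zero-lemma x
  where
  zero-lemma : ∀ x → 0ℚ + x * 0ℚ ≡ 0ℚ
  zero-lemma = solve-∀ ℚ-ring
shift-[1+xt] x f (suc i) = refl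

-- The right side is symmetric in x and y, which yields commutation of the linear factors; for xy =
-- 1 it is the trinomial operator. The case split follows that of `shift`.
[1+xt]-∘ : ∀ x y f i → [1+ x t] ([1+ y t] f) i ≡ [1+ (x + y) t] f i + (x * y) * shift (shift f) i
[1+xt]-∘ x y f zero    = lemma x y (f 0)
  where
  lemma : ∀ x y a → (a + y * 0ℚ) + x * 0ℚ ≡ (a + (x + y) * 0ℚ) + (x * y) * 0ℚ
  lemma = solve-∀ ℚ-ring
[1+xt]-∘ x y f (suc i) = lemma x y (f (suc i)) (f i) (shift f i)
  where
  lemma : ∀ x y a b c → (a + y * b) + x * (b + y * c) ≡ (a + (x + y) * b) + (x * y) * c
  lemma = solve-∀ ℚ-ring

[1+xt]-commute : ∀ x y → Commute [1+ x t] [1+ y t]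
[1+xt]-commute x y f i = begin
  [1+ x t] ([1+ y t] f) i                              ≡⟨ [1+xt]-∘ x y f i ⟩
  [1+ (x + y) t] f i + (x * y) * shift (shift f) i     ≡⟨ cong₂ (λ s p → [1+ s t] f i + p * shift (shift f) i) (ℚ.+-comm x y) (ℚ.*-comm x y) ⟩
  [1+ (y + x) t] f i + (y * x) * shift (shift f) i     ≡⟨ [1+xt]-∘ y x f i ⟨
  [1+ y t] ([1+ x t] f) i                              ∎
  where open ≡-Reasoning

shift↑-≤ : ∀ k {i} f → k ℕ.≤ i → (shift ↑ k) f i ≡ f (i ℕ.∸ k)
shift↑-≤ zero    f k≤i = refl
shift↑-≤ (suc k) {suc i} f (s≤s k≤i) = trans
  (shift↑-≤ k (shift f) (ℕ.m≤n⇒m≤1+n k≤i))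
  (cong (shift f) (ℕ.+-∸-assoc 1 k≤i))

shift↑-> : ∀ k {i} f → i ℕ.< k → (shift ↑ k) f i ≡ 0ℚ
shift↑-> (suc k) {i} f (s≤s i≤k) with ℕ.m≤n⇒m<n∨m≡n i≤k
... | inj₁ i<k  = shift↑-> k (shift f) i<k
-- The boundary index: k shifts bring it down to index 0 of `shift f`, where the remaining shift has
-- put 0.
... | inj₂ refl = trans (shift↑-≤ k (shift f) ℕ.≤-refl) (cong (shift f) (ℕ.n∸n≡0 k))

shift²↑ : ∀ k f → ((shift ∘ shift) ↑ k) f ≡ (shift ↑ (2 ℕ.* k)) f
shift²↑ zero    f = refl
shift²↑ (suc k) f = trans (shift²↑ k (shift (shift f)))
  (cong (λ l → (shift ↑ l) f) (sym (ℕ.*-suc 2 k)))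

scale-shift↑ : ∀ x k f i → ((scale x ∘ shift) ↑ k) f i ≡ x ^ k * (shift ↑ k) f i
scale-shift↑ x zero    f i = sym (ℚ.*-identityˡ (f i))
scale-shift↑ x (suc k) f i = begin
  ((scale x ∘ shift) ↑ k) (scale x (shift f)) i  ≡⟨ scale-shift↑ x k (scale x (shift f)) i ⟩
  x ^ k * (shift ↑ k) (scale x (shift f)) i      ≡⟨ cong (x ^ k *_) (↑-commute shift-additive shift-scale k (shift f) i) ⟩
  x ^ k * (x * (shift ↑ suc k) f i)              ≡⟨ rearrange (x ^ k) x _ ⟩
  x ^ suc k * (shift ↑ suc k) f i                ∎
  where
  open ≡-Reasoning
  rearrange : ∀ a b c → a * (b * c) ≡ (b * a) * c
  rearrange = solve-∀ ℚ-ring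
  shift-scale : Commute shift (scale x)
  shift-scale f zero    = sym (ℚ.*-zeroʳ x)
  shift-scale f (suc i) = refl

id↑ : ∀ n f → (id ↑ n) f ≡ f
id↑ zero    f = refl
id↑ (suc n) f = id↑ n f

[1+xt]↑ : ∀ x n f i → ([1+ x t] ↑ n) f i ≡ binomialSum n (λ k → x ^ k * (shift ↑ k) f i)
[1+xt]↑ x n f i = trans
  (↑-binomial id-additive (xt-additive x) (λ _ _ → refl) (λ _ _ → refl) n f i)
  (binomialSum-cong n λ {k} _ → trans
    (cong (λ h → ((scale x ∘ shift) ↑ k) h i) (id↑ (n ℕ.∸ k) f))
    (scale-shift↑ x k f i))

[1+xt]↑-δ : ∀ x n i → ([1+ x t] ↑ n) δ i ≡ fromℕ (n C i) * x ^ i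
[1+xt]↑-δ x zero    zero    = refl
[1+xt]↑-δ x zero    (suc i) = sym (ℚ.*-zeroˡ (x ^ suc i))
-- The innermost factor is brought to the outside, where it combines two neighbouring coefficients
-- of the n-th power as in Pascal's rule.
[1+xt]↑-δ x (suc n) i = trans (↑-commute {B = [1+ x t]} ([1+xt]-additive x) (λ _ _ → refl) n δ i) (step i)
  where
  open ≡-Reasoning
  step : ∀ i → [1+ x t] (([1+ x t] ↑ n) δ) i ≡ fromℕ (suc n C i) * x ^ i
  step zero = begin
    ([1+ x t] ↑ n) δ 0 + x * 0ℚ   ≡⟨ cong₂ _+_ ([1+xt]↑-δ x n 0) (ℚ.*-zeroʳ x) ⟩
    1ℚ * 1ℚ + 0ℚ                  ∎
  step (suc i) = begin
    ([1+ x t] ↑ n) δ (suc i) + x * ([1+ x t] ↑ n) δ i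
      ≡⟨ cong₂ (λ a b → a + x * b) ([1+xt]↑-δ x n (suc i)) ([1+xt]↑-δ x n i) ⟩
    fromℕ (n C suc i) * (x * x ^ i) + x * (fromℕ (n C i) * x ^ i)
      ≡⟨ rearrange x (fromℕ (n C suc i)) (fromℕ (n C i)) (x ^ i) ⟩
    (fromℕ (n C i) + fromℕ (n C suc i)) * (x * x ^ i)
      ≡⟨ cong (_* x ^ suc i) (fromℕ-C-suc n i) ⟨
    fromℕ (suc n C suc i) * x ^ suc i ∎
    where
    rearrange : ∀ x a b c → a * (x * c) + x * (b * c) ≡ (b + a) * (x * c)
    rearrange = solve-∀ ℚ-ring

n/2<m⇒n<2m : ∀ {n m} → suc (n ℕ./ 2) ℕ.≤ m → n ℕ.< 2 ℕ.* m
n/2<m⇒n<2m {n} {m} n/2<m = begin-strict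
  n                              ≡⟨ ℕ.m≡m%n+[m/n]*n n 2 ⟩
  n ℕ.% 2 ℕ.+ n ℕ./ 2 ℕ.* 2      <⟨ ℕ.+-monoˡ-< (n ℕ./ 2 ℕ.* 2) (ℕ.m%n<n n 2) ⟩
  suc (n ℕ./ 2) ℕ.* 2            ≤⟨ ℕ.*-monoˡ-≤ 2 n/2<m ⟩
  m ℕ.* 2                        ≡⟨ ℕ.*-comm m 2 ⟩
  2 ℕ.* m                        ∎
  where open ℕ.≤-Reasoning

m≤n/2⇒2m≤n : ∀ {n m} → m ℕ.≤ n ℕ./ 2 → 2 ℕ.* m ℕ.≤ n
m≤n/2⇒2m≤n {n} {m} m≤n/2 = ℕ.≤-trans (ℕ.*-monoʳ-≤ 2 m≤n/2)
  (subst (ℕ._≤ n) (ℕ.*-comm (n ℕ./ 2) 2) (ℕ.m/n*n≤m n 2))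

-- Both sides are the coefficient of tⁿ in (1 + (x+y)t + t²)ⁿ = (1 + xt)ⁿ(1 + yt)ⁿ.
centralTrinomial : ∀ n x y → x * y ≡ 1ℚ →
  ∑[ k < suc (n ℕ./ 2) ] (fromℕ (n C toℕ k) * (fromℕ ((n ℕ.∸ toℕ k) C (n ℕ.∸ 2 ℕ.* toℕ k)) * (x + y) ^ (n ℕ.∸ 2 ℕ.* toℕ k)))
  ≡ binomialSum n (λ j → x ^ j * (fromℕ (n C (n ℕ.∸ j)) * y ^ (n ℕ.∸ j)))
centralTrinomial n x y xy≡1 = begin
  ∑[ k < suc (n ℕ./ 2) ] (fromℕ (n C toℕ k) * (fromℕ ((n ℕ.∸ toℕ k) C (n ℕ.∸ 2 ℕ.* toℕ k)) * w ^ (n ℕ.∸ 2 ℕ.* toℕ k)))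
    ≡⟨ sum-cong-< (suc (n ℕ./ 2)) (λ { {k} (s≤s k≤) → cong (fromℕ (n C k) *_) (sym (trans
         (shift↑-≤ (2 ℕ.* k) (([1+ w t] ↑ (n ℕ.∸ k)) δ) (m≤n/2⇒2m≤n k≤))
         ([1+xt]↑-δ w (n ℕ.∸ k) (n ℕ.∸ 2 ℕ.* k)))) }) ⟩
  ∑[ k < suc (n ℕ./ 2) ] (fromℕ (n C toℕ k) * g (toℕ k))
    -- The Legendre range stops at n/2, the binomial theorem at n. In between, t²ᵏ has degree above
    -- n and contributes nothing to the coefficient of tⁿ.
    ≡⟨ sum-truncate (s≤s (ℕ.m/n≤m n 2)) (λ k → fromℕ (n C k) * g k) (λ {k} k> →
         trans (cong (fromℕ (n C k) *_) (shift↑-> (2 ℕ.* k) (([1+ w t] ↑ (n ℕ.∸ k)) δ) (n/2<m⇒n<2m k>)))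
               (ℚ.*-zeroʳ (fromℕ (n C k)))) ⟨
  binomialSum n g
    ≡⟨ binomialSum-cong n (λ {k} _ → cong (λ h → h n) (shift²↑ k (([1+ w t] ↑ (n ℕ.∸ k)) δ))) ⟨
  binomialSum n (λ k → ((shift ∘ shift) ↑ k) (([1+ w t] ↑ (n ℕ.∸ k)) δ) n)
    ≡⟨ ↑-binomial ([1+xt]-additive w) (∘-additive shift-additive shift-additive) shift²-commute (λ _ _ → refl) n δ n ⟨
  ([1+ w t+t²] ↑ n) δ n
    -- The factorisation needs xy = 1 in order that t² have coefficient 1.
    ≡⟨ ↑-∘ ([1+xt]-additive x) ([1+xt]-additive y) ([1+xt]-commute x y) factor n δ n ⟨
  ([1+ x t] ↑ n) (([1+ y t] ↑ n) δ) n
    ≡⟨ [1+xt]↑ x n (([1+ y t] ↑ n) δ) n ⟩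
  binomialSum n (λ j → x ^ j * (shift ↑ j) (([1+ y t] ↑ n) δ) n)
    ≡⟨ binomialSum-cong n (λ {j} j≤n → cong (x ^ j *_) (trans
         (shift↑-≤ j (([1+ y t] ↑ n) δ) j≤n) ([1+xt]↑-δ y n (n ℕ.∸ j)))) ⟩
  binomialSum n (λ j → x ^ j * (fromℕ (n C (n ℕ.∸ j)) * y ^ (n ℕ.∸ j))) ∎
  where
  open ≡-Reasoning
  w = x + y
  g : ℕ → ℚ
  g k = (shift ↑ (2 ℕ.* k)) (([1+ w t] ↑ (n ℕ.∸ k)) δ) n
  shift²-commute : Commute [1+ w t] (shift ∘ shift)
  shift²-commute f i = trans (shift-[1+xt] w (shift f) i) (cong-≗ shift-additive (shift-[1+xt] w f) i)
  factor : ∀ f → [1+ x t] ([1+ y t] f) ≗ [1+ w t+t²] f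
  factor f i = trans ([1+xt]-∘ x y f i) (cong (λ s → [1+ w t] f i + s) (trans
    (cong (_* shift (shift f) i) xy≡1) (ℚ.*-identityˡ (shift (shift f) i))))

-- Congruences in ℤ₍ p ₎

coprime-* : ∀ {m n o} → Coprime m o → Coprime n o → Coprime (m ℕ.* n) o
coprime-* m⊥o n⊥o {d} (d∣mn , d∣o) = n⊥o (coprime-divisor d⊥m d∣mn , d∣o)
  where
  d⊥m : Coprime d _
  d⊥m (e∣d , e∣m) = m⊥o (e∣m , ℕ∣.∣-trans e∣d d∣o)

prime∤⇒coprime : ∀ {p n} → Prime p → ¬ p ∣ n → Coprime n p
prime∤⇒coprime pr p∤n (d∣n , d∣p) with prime⇒irreducible pr d∣p
... | inj₁ d≡1  = d≡1
... | inj₂ refl = contradiction d∣n p∤n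

+∈ : ∀ {p} a b → a ∈ℤ₍ p ₎ → b ∈ℤ₍ p ₎ → a + b ∈ℤ₍ p ₎
-- Matching on the records exposes the sum as a fraction over the product of the denominators; `/∈`
-- accounts for the passage to lowest terms.
+∈ a@record{} b@record{} a∈ b∈ = /∈ (↥ a ℤ.* ℚ.↧ b ℤ.+ ↥ b ℤ.* ℚ.↧ a) (↧ₙ a ℕ.* ↧ₙ b) (coprime-* a∈ b∈)

*∈ : ∀ {p} a b → a ∈ℤ₍ p ₎ → b ∈ℤ₍ p ₎ → a * b ∈ℤ₍ p ₎
*∈ a@record{} b@record{} a∈ b∈ = /∈ (↥ a ℤ.* ↥ b) (↧ₙ a ℕ.* ↧ₙ b) (coprime-* a∈ b∈)

^∈ : ∀ {p} a n → a ∈ℤ₍ p ₎ → a ^ n ∈ℤ₍ p ₎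
^∈ a zero    a∈ = fromℤ∈ 1ℤ
^∈ a (suc n) a∈ = *∈ a (a ^ n) a∈ (^∈ a n a∈)

≡mod-refl : ∀ {p a} → a ∈ℤ₍ p ₎ → a ≡ a [mod p ]
≡mod-refl {p} {a} a∈ = record
  { left∈ = a∈ ; right∈ = a∈ ; quotient = 0ℚ ; quotient∈ = fromℤ∈ 0ℤ
  ; difference = trans (ℚ.+-inverseʳ a) (sym (ℚ.*-zeroʳ (fromℕ p))) }

≡mod-sym : ∀ {p a b} → a ≡ b [mod p ] → b ≡ a [mod p ]
≡mod-sym {p} {a} {b} a≡b = record
  { left∈ = right∈ a≡b ; right∈ = left∈ a≡b
  ; quotient = - quotient a≡b ; quotient∈ = neg∈ (quotient a≡b) (quotient∈ a≡b)
  ; difference = begin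
      b - a                              ≡⟨ lem₁ a b ⟩
      - (a - b)                          ≡⟨ cong -_ (difference a≡b) ⟩
      - (fromℕ p * quotient a≡b)         ≡⟨ lem₂ (fromℕ p) (quotient a≡b) ⟩
      fromℕ p * - quotient a≡b           ∎ }
  where
  open ≡-Reasoning
  lem₁ : ∀ a b → b - a ≡ - (a - b)
  lem₁ = solve-∀ ℚ-ring
  lem₂ : ∀ a b → - (a * b) ≡ a * - b
  lem₂ = solve-∀ ℚ-ring

≡mod-trans : ∀ {p a b c} → a ≡ b [mod p ] → b ≡ c [mod p ] → a ≡ c [mod p ]
≡mod-trans {p} {a} {b} {c} a≡b b≡c = record
  { left∈ = left∈ a≡b ; right∈ = right∈ b≡c
  ; quotient = q + r ; quotient∈ = +∈ q r (quotient∈ a≡b) (quotient∈ b≡c)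
  ; difference = begin
      a - c                        ≡⟨ lem a b c ⟩
      (a - b) + (b - c)            ≡⟨ cong₂ _+_ (difference a≡b) (difference b≡c) ⟩
      fromℕ p * q + fromℕ p * r    ≡⟨ ℚ.*-distribˡ-+ (fromℕ p) q r ⟨
      fromℕ p * (q + r)            ∎ }
  where
  open ≡-Reasoning
  q = quotient a≡b
  r = quotient b≡c
  lem : ∀ a b c → a - c ≡ (a - b) + (b - c)
  lem = solve-∀ ℚ-ring

+-cong-mod : ∀ {p a b c d} → a ≡ b [mod p ] → c ≡ d [mod p ] → a + c ≡ b + d [mod p ]
+-cong-mod {p} {a} {b} {c} {d} a≡b c≡d = record
  { left∈ = +∈ a c (left∈ a≡b) (left∈ c≡d) ; right∈ = +∈ b d (right∈ a≡b) (right∈ c≡d)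
  ; quotient = q + r ; quotient∈ = +∈ q r (quotient∈ a≡b) (quotient∈ c≡d)
  ; difference = begin
      (a + c) - (b + d)            ≡⟨ lem a b c d ⟩
      (a - b) + (c - d)            ≡⟨ cong₂ _+_ (difference a≡b) (difference c≡d) ⟩
      fromℕ p * q + fromℕ p * r    ≡⟨ ℚ.*-distribˡ-+ (fromℕ p) q r ⟨
      fromℕ p * (q + r)            ∎ }
  where
  open ≡-Reasoning
  q = quotient a≡b
  r = quotient c≡d
  lem : ∀ a b c d → (a + c) - (b + d) ≡ (a - b) + (c - d)
  lem = solve-∀ ℚ-ring

*-cong-mod : ∀ {p a b c d} → a ≡ b [mod p ] → c ≡ d [mod p ] → a * c ≡ b * d [mod p ]
*-cong-mod {p} {a} {b} {c} {d} a≡b c≡d = record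
  { left∈ = *∈ a c (left∈ a≡b) (left∈ c≡d) ; right∈ = *∈ b d (right∈ a≡b) (right∈ c≡d)
  ; quotient = q * c + b * r
  ; quotient∈ = +∈ (q * c) (b * r) (*∈ q c (quotient∈ a≡b) (left∈ c≡d)) (*∈ b r (right∈ a≡b) (quotient∈ c≡d))
  ; difference = begin
      a * c - b * d                          ≡⟨ lem₁ a b c d ⟩
      (a - b) * c + b * (c - d)              ≡⟨ cong₂ (λ s t → s * c + b * t) (difference a≡b) (difference c≡d) ⟩
      fromℕ p * q * c + b * (fromℕ p * r)    ≡⟨ lem₂ (fromℕ p) b c q r ⟩
      fromℕ p * (q * c + b * r)              ∎ }
  where
  open ≡-Reasoning
  q = quotient a≡b
  r = quotient c≡d
  lem₁ : ∀ a b c d → a * c - b * d ≡ (a - b) * c + b * (c - d)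
  lem₁ = solve-∀ ℚ-ring
  lem₂ : ∀ p b c q r → p * q * c + b * (p * r) ≡ p * (q * c + b * r)
  lem₂ = solve-∀ ℚ-ring

^-cong-mod : ∀ {p a b} n → a ≡ b [mod p ] → a ^ n ≡ b ^ n [mod p ]
^-cong-mod zero    a≡b = ≡mod-refl (fromℤ∈ 1ℤ)
^-cong-mod (suc n) a≡b = *-cong-mod a≡b (^-cong-mod n a≡b)

sum-cong-mod : ∀ {p} n {f g : Fin n → ℚ} → (∀ k → f k ≡ g k [mod p ]) →
  ∑[ k < n ] f k ≡ ∑[ k < n ] g k [mod p ]
sum-cong-mod zero    f≡g = ≡mod-refl (fromℤ∈ 0ℤ)
sum-cong-mod (suc n) f≡g = +-cong-mod (f≡g zero) (sum-cong-mod n (f≡g ∘ suc))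

fromℤ-neg : ∀ i → fromℤ (ℤ.- i) ≡ - fromℤ i
fromℤ-neg i = inverseʳ-unique (fromℤ i) (fromℤ (ℤ.- i)) (begin
  fromℤ i + fromℤ (ℤ.- i)   ≡⟨ fromℤ-+ i (ℤ.- i) ⟨
  fromℤ (i ℤ.- i)           ≡⟨ cong fromℤ (ℤ.+-inverseʳ i) ⟩
  0ℚ                        ∎)
  where open ≡-Reasoning

fromℤ-^ : ∀ i n → fromℤ (i ℤ.^ n) ≡ fromℤ i ^ n
fromℤ-^ i zero    = refl
fromℤ-^ i (suc n) = trans (fromℤ-* i (i ℤ.^ n)) (cong (fromℤ i *_) (fromℤ-^ i n))

fromℤ-cong-mod : ∀ {p i j} → + p ℤ∣.∣ i ℤ.- j → fromℤ i ≡ fromℤ j [mod p ]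
fromℤ-cong-mod {p} {i} {j} (ℤ∣.divides q eq) = record
  { left∈ = fromℤ∈ i ; right∈ = fromℤ∈ j ; quotient = fromℤ q ; quotient∈ = fromℤ∈ q
  ; difference = begin
      fromℤ i - fromℤ j         ≡⟨ cong (λ s → fromℤ i + s) (fromℤ-neg j) ⟨
      fromℤ i + fromℤ (ℤ.- j)   ≡⟨ fromℤ-+ i (ℤ.- j) ⟨
      fromℤ (i ℤ.- j)           ≡⟨ cong fromℤ eq ⟩
      fromℤ (q ℤ.* + p)         ≡⟨ cong fromℤ (ℤ.*-comm q (+ p)) ⟩
      fromℤ (+ p ℤ.* q)         ≡⟨ fromℤ-* (+ p) q ⟩
      fromℕ p * fromℤ q         ∎ }
  where open ≡-Reasoning


-- Inversion of a reduced fraction exchanges numerator and denominator with no cancellation, so in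
-- each sign case the new denominator is the absolute value of the old numerator.
1/∈ : ∀ {p} a .{{_ : ℚ.NonZero a}} → Coprime ℤ.∣ ↥ a ∣ p → 1/ a ∈ℤ₍ p ₎
1/∈ (mkℚ ℤ.+[1+ n ] d _)   c = c
1/∈ (mkℚ (ℤ.-[1+ n ]) d _) c = c

*-/ : ∀ i j d .{{_ : ℕ.NonZero d}} → (i ℤ.* j) / d ≡ fromℤ i * (j / d)
*-/ i j d@(suc d-1) = ℚ.toℚᵘ-injective (begin
  ℚ.toℚᵘ ((i ℤ.* j) / d)                     ≈⟨ ℚ.toℚᵘ-fromℚᵘ (mkℚᵘ (i ℤ.* j) d-1) ⟩
  mkℚᵘ (i ℤ.* j) d-1                         ≡⟨ cong (mkℚᵘ (i ℤ.* j)) (ℕ.+-identityʳ d-1) ⟨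
  mkℚᵘ i 0 ℚᵘ.* mkℚᵘ j d-1                   ≈⟨ ℚᵘ.*-cong (ℚ.toℚᵘ-fromℚᵘ (mkℚᵘ i 0)) (ℚ.toℚᵘ-fromℚᵘ (mkℚᵘ j d-1)) ⟨
  ℚ.toℚᵘ (fromℤ i) ℚᵘ.* ℚ.toℚᵘ (j / d)       ≈⟨ ℚ.toℚᵘ-homo-* (fromℤ i) (j / d) ⟨
  ℚ.toℚᵘ (fromℤ i * (j / d))                 ∎)
  where open ℚᵘ.≃-Reasoning

/-cancel : ∀ i d .{{_ : ℕ.NonZero d}} → (i ℤ.* + d) / d ≡ fromℤ i
/-cancel i d@(suc d-1) = ℚ.fromℚᵘ-cong {mkℚᵘ (i ℤ.* + d) d-1} {mkℚᵘ i 0} (*≡* (ℤ.*-identityʳ (i ℤ.* + d)))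

-- Serves by contraposition: if x is nonzero modulo p then its numerator is prime to p, which puts
-- 1/x in ℤ₍ p ₎.
p∣↥⇒≡0 : ∀ {p} a → a ∈ℤ₍ p ₎ → p ∣ ℤ.∣ ↥ a ∣ → a ≡ 0ℚ [mod p ]
p∣↥⇒≡0 {p} a a∈ p∣↥ with ℤ∣.∣ᵤ⇒∣ {+ p} {↥ a} p∣↥
... | ℤ∣.divides q eq = record
  { left∈ = a∈ ; right∈ = fromℤ∈ 0ℤ ; quotient = q / ↧ₙ a ; quotient∈ = /∈ q (↧ₙ a) a∈
  ; difference = begin
      a - 0ℚ                    ≡⟨ ℚ.+-identityʳ a ⟩
      a                         ≡⟨ ℚ.↥p/↧p≡p a ⟨
      ↥ a / ↧ₙ a                ≡⟨ cong (_/ ↧ₙ a) (trans eq (ℤ.*-comm q (+ p))) ⟩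
      (+ p ℤ.* q) / ↧ₙ a        ≡⟨ *-/ (+ p) q (↧ₙ a) ⟩
      fromℕ p * (q / ↧ₙ a)      ∎ }
  where open ≡-Reasoning

1/∈-≢0 : ∀ {p} a .{{_ : ℚ.NonZero a}} → Prime p → a ∈ℤ₍ p ₎ → ¬ (a ≡ 0ℚ [mod p ]) → 1/ a ∈ℤ₍ p ₎
1/∈-≢0 a pr a∈ a≢0 = 1/∈ a (prime∤⇒coprime pr (a≢0 ∘ p∣↥⇒≡0 a a∈))

-- Binomial coefficient identities, and bridges between forms of integer arithmetic

C*k!*[n∸k]! : ∀ {n k} → k ℕ.≤ n → (n C k) ℕ.* (k ! ℕ.* (n ℕ.∸ k) !) ≡ n !
C*k!*[n∸k]! {n} {k} k≤n = trans (cong (ℕ._* (k ! ℕ.* (n ℕ.∸ k) !)) (nCk≡n!/k![n-k]! k≤n))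
  (ℕ.m/n*n≡m (k![n∸k]!∣n! k≤n))
  where instance _ = k ℕ.!* (n ℕ.∸ k) !≢0

-- The absorption identity, the common source of p dividing `p C k` and of the recurrences used for
-- the central binomial coefficients. The factorial formula covers k ≤ n; beyond that both sides
-- vanish.
C-absorb : ∀ n k → suc k ℕ.* (suc n C suc k) ≡ suc n ℕ.* (n C k)
C-absorb n k with k ℕ.≤? n
... | no  k≰n = begin
  suc k ℕ.* (suc n C suc k)  ≡⟨ cong (suc k ℕ.*_) (k>n⇒nCk≡0 (s≤s (ℕ.≰⇒> k≰n))) ⟩
  suc k ℕ.* 0                ≡⟨ ℕ.*-zeroʳ (suc k) ⟩
  0                          ≡⟨ ℕ.*-zeroʳ (suc n) ⟨
  suc n ℕ.* 0                ≡⟨ cong (suc n ℕ.*_) (k>n⇒nCk≡0 (ℕ.≰⇒> k≰n)) ⟨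
  suc n ℕ.* (n C k)          ∎
  where open ≡-Reasoning
... | yes k≤n = ℕ.*-cancelʳ-≡ _ _ (k ! ℕ.* (n ℕ.∸ k) !) (begin
  suc k ℕ.* (suc n C suc k) ℕ.* (k ! ℕ.* (n ℕ.∸ k) !)   ≡⟨ rearrange (suc k) (suc n C suc k) (k !) ((n ℕ.∸ k) !) ⟩
  (suc n C suc k) ℕ.* (suc k ! ℕ.* (n ℕ.∸ k) !)         ≡⟨ C*k!*[n∸k]! (s≤s k≤n) ⟩
  suc n ℕ.* n !                                         ≡⟨ cong (suc n ℕ.*_) (C*k!*[n∸k]! k≤n) ⟨
  suc n ℕ.* ((n C k) ℕ.* (k ! ℕ.* (n ℕ.∸ k) !))         ≡⟨ ℕ.*-assoc (suc n) (n C k) _ ⟨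
  suc n ℕ.* (n C k) ℕ.* (k ! ℕ.* (n ℕ.∸ k) !)           ∎)
  where
  open ≡-Reasoning
  instance _ = k ℕ.!* (n ℕ.∸ k) !≢0
  rearrange : ∀ a b c d → a ℕ.* b ℕ.* (c ℕ.* d) ≡ b ℕ.* ((a ℕ.* c) ℕ.* d)
  rearrange = ℕ-solver.solve-∀

×≡* : ∀ n i → n × i ≡ + n ℤ.* i
×≡* zero    i = sym (ℤ.*-zeroˡ i)
×≡* (suc n) i = trans (cong (λ t → i ℤ.+ t) (×≡* n i)) (sym (ℤ.suc-* (+ n) i))

^ᴿ≡^ : ∀ i n → i ^ᴿ n ≡ i ℤ.^ n
^ᴿ≡^ i zero    = refl
^ᴿ≡^ i (suc n) = cong (i ℤ.*_) (^ᴿ≡^ i n)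

∣+m-+n∣≡∣m-n∣ : ∀ m n → ℤ.∣ + m ℤ.- + n ∣ ≡ ℕ.∣ m - n ∣
∣+m-+n∣≡∣m-n∣ m n = trans (cong ℤ.∣_∣ (ℤ.[+m]-[+n]≡m⊖n m n)) (lemma (ℕ.≤-total m n))
  where
  lemma : m ℕ.≤ n ⊎ n ℕ.≤ m → ℤ.∣ m ℤ.⊖ n ∣ ≡ ℕ.∣ m - n ∣
  lemma (inj₁ m≤n) = trans (ℤ.∣⊖∣-≤ m≤n) (sym (ℕ.m≤n⇒∣m-n∣≡n∸m m≤n))
  lemma (inj₂ n≤m) = trans (trans (ℤ.∣m⊖n∣≡∣n⊖m∣ m n) (ℤ.∣⊖∣-≤ n≤m)) (sym (ℕ.m≤n⇒∣n-m∣≡n∸m n≤m))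

-- Euler's criterion

∣-sym : ∀ {d i j} → d ℤ∣.∣ i ℤ.- j → d ℤ∣.∣ j ℤ.- i
∣-sym {d} {i} {j} d∣ = subst (d ℤ∣.∣_) (lemma i j) (ℤ∣.∣m⇒∣-m d∣)
  where
  lemma : ∀ i j → ℤ.- (i ℤ.- j) ≡ j ℤ.- i
  lemma = ℤ-solver.solve-∀

∣-trans : ∀ {d} i j k → d ℤ∣.∣ i ℤ.- j → d ℤ∣.∣ j ℤ.- k → d ℤ∣.∣ i ℤ.- k
∣-trans {d} i j k p q = subst (d ℤ∣.∣_) (lemma i j k) (ℤ∣.∣m∣n⇒∣m+n p q)
  where
  lemma : ∀ i j k → (i ℤ.- j) ℤ.+ (j ℤ.- k) ≡ i ℤ.- k
  lemma = ℤ-solver.solve-∀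

∣-^-cong : ∀ {d} i j n → d ℤ∣.∣ i ℤ.- j → d ℤ∣.∣ i ℤ.^ n ℤ.- j ℤ.^ n
∣-^-cong i j zero    d∣ = ℤ∣.divides 0ℤ refl
∣-^-cong {d} i j (suc n) d∣ = subst (d ℤ∣.∣_) (lemma i j (i ℤ.^ n) (j ℤ.^ n))
  (ℤ∣.∣m∣n⇒∣m+n (ℤ∣.∣m⇒∣m*n (i ℤ.^ n) d∣) (ℤ∣.∣n⇒∣m*n j (∣-^-cong i j n d∣)))
  where
  lemma : ∀ i j a b → (i ℤ.- j) ℤ.* a ℤ.+ j ℤ.* (a ℤ.- b) ≡ i ℤ.* a ℤ.- j ℤ.* b
  lemma = ℤ-solver.solve-∀

∣-∣⇒ : ∀ {p} m n → p ∣ ℕ.∣ m - n ∣ → + p ℤ∣.∣ + m ℤ.- + n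
∣-∣⇒ {p} m n p∣ = ℤ∣.∣ᵤ⇒∣ (subst (p ∣_) (sym (∣+m-+n∣≡∣m-n∣ m n)) p∣)

⇒∣-∣ : ∀ {p} m n → + p ℤ∣.∣ + m ℤ.- + n → p ∣ ℕ.∣ m - n ∣
⇒∣-∣ {p} m n p∣ = subst (p ∣_) (∣+m-+n∣≡∣m-n∣ m n) (ℤ∣.∣⇒∣ᵤ p∣)

∣∧<⇒≡0 : ∀ {m n} → m ∣ n → n ℕ.< m → n ≡ 0
∣∧<⇒≡0 {n = zero}  m∣n n<m = refl
∣∧<⇒≡0 {n = suc n} m∣n n<m = contradiction m∣n (ℕ∣.>⇒∤ n<m)

∣-sum : ∀ {d n} (f : Fin n → ℤ) → (∀ i → d ℤ∣.∣ f i) → d ℤ∣.∣ sum f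
∣-sum {n = zero}  f d∣ = ℤ∣.divides 0ℤ refl
∣-sum {n = suc n} f d∣ = ℤ∣.∣m∣n⇒∣m+n (d∣ zero) (∣-sum (f ∘ suc) (d∣ ∘ suc))

-- The coefficient list cs stands for the monic polynomial of degree n whose
-- remaining coefficients are cs, constant term first.
⟦_⟧ : ∀ {n} → Vec ℤ n → ℤ → ℤ
⟦ []     ⟧ x = 1ℤ
⟦ c ∷ cs ⟧ x = c ℤ.+ x ℤ.* ⟦ cs ⟧ x

-- Synthetic division by x - r: the coefficients of the quotient are the partial values of Horner's
-- scheme at r. The quotient is again monic, so its leading 1 stays implicit.
deflate : ∀ {n} → Vec ℤ (suc n) → ℤ → Vec ℤ n
deflate (c ∷ [])         r = []
deflate (c ∷ cs@(_ ∷ _)) r = ⟦ cs ⟧ r ∷ deflate cs r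

deflate-correct : ∀ {n} (cs : Vec ℤ (suc n)) x r →
  ⟦ cs ⟧ x ℤ.- ⟦ cs ⟧ r ≡ (x ℤ.- r) ℤ.* ⟦ deflate cs r ⟧ x
deflate-correct (c ∷ []) x r = lemma c x r
  where
  lemma : ∀ c x r → (c ℤ.+ x ℤ.* 1ℤ) ℤ.- (c ℤ.+ r ℤ.* 1ℤ) ≡ (x ℤ.- r) ℤ.* 1ℤ
  lemma = ℤ-solver.solve-∀
deflate-correct (c ∷ cs@(_ ∷ _)) x r = begin
  (c ℤ.+ x ℤ.* f) ℤ.- (c ℤ.+ r ℤ.* g)            ≡⟨ lemma₁ c x r f g ⟩
  (x ℤ.- r) ℤ.* g ℤ.+ x ℤ.* (f ℤ.- g)            ≡⟨ cong (λ t → (x ℤ.- r) ℤ.* g ℤ.+ x ℤ.* t) (deflate-correct cs x r) ⟩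
  (x ℤ.- r) ℤ.* g ℤ.+ x ℤ.* ((x ℤ.- r) ℤ.* q)    ≡⟨ lemma₂ (x ℤ.- r) g x q ⟩
  (x ℤ.- r) ℤ.* (g ℤ.+ x ℤ.* q)                  ∎
  where
  open ≡-Reasoning
  f = ⟦ cs ⟧ x
  g = ⟦ cs ⟧ r
  q = ⟦ deflate cs r ⟧ x
  lemma₁ : ∀ c x r f g → (c ℤ.+ x ℤ.* f) ℤ.- (c ℤ.+ r ℤ.* g) ≡ (x ℤ.- r) ℤ.* g ℤ.+ x ℤ.* (f ℤ.- g)
  lemma₁ = ℤ-solver.solve-∀
  lemma₂ : ∀ d g x q → d ℤ.* g ℤ.+ x ℤ.* (d ℤ.* q) ≡ d ℤ.* (g ℤ.+ x ℤ.* q)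
  lemma₂ = ℤ-solver.solve-∀

⟦replicate⟧ : ∀ n x → ⟦ replicate n 0ℤ ⟧ x ≡ x ℤ.^ n
⟦replicate⟧ zero    x = refl
⟦replicate⟧ (suc n) x = trans (ℤ.+-identityˡ _) (cong (x ℤ.*_) (⟦replicate⟧ n x))

-- For m = 0 the polynomial would be 0, which is not monic; the value there is a filler, excluded by
-- `0 < m` in `⟦xᵐ-1⟧`.
xᵐ-1 : ∀ m → Vec ℤ m
xᵐ-1 zero    = []
xᵐ-1 (suc m) = -1ℤ ∷ replicate m 0ℤ

⟦xᵐ-1⟧ : ∀ m → 0 ℕ.< m → ∀ x → ⟦ xᵐ-1 m ⟧ x ≡ x ℤ.^ m ℤ.- 1ℤ
⟦xᵐ-1⟧ (suc m) _ x = trans (cong (λ t → -1ℤ ℤ.+ x ℤ.* t) (⟦replicate⟧ m x)) (ℤ.+-comm -1ℤ (x ℤ.^ suc m))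

-- Passing both decisions as arguments to `by-cases` lets the nested `if` in `legendre` reduce by
-- matching on them.
legendre-elim : ∀ {p} (P : ℤ → Set) (r : Fin p) →
  (toℕ r ≡ 0 → P 0ℤ) →
  (toℕ r ≢ 0 → QuadraticResidue r → P 1ℤ) →
  (toℕ r ≢ 0 → ¬ QuadraticResidue r → P -1ℤ) →
  P (legendre r)
legendre-elim P r P0 P1 P-1 = by-cases (toℕ r ℕ.≟ 0) (quadraticResidue? r)
  where
  by-cases : (z? : Dec (toℕ r ≡ 0)) (q? : Dec (QuadraticResidue r)) →
    P (if ⌊ z? ⌋ then 0ℤ else if ⌊ q? ⌋ then 1ℤ else -1ℤ)
  by-cases (yes r≡0) _        = P0 r≡0
  by-cases (no  r≢0) (yes qr) = P1 r≢0 qr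
  by-cases (no  r≢0) (no ¬qr) = P-1 r≢0 ¬qr

-- In the binomial expansion all inner terms are divisible by n, and the two end terms are 1 and iⁿ.
-- Divisibility of the inner coefficients is a hypothesis here, so that n can be matched as `suc q`
-- and both ends split off the sum.
frobenius : ∀ n .{{_ : NonZero n}} → (∀ {k} → 0 ℕ.< k → k ℕ.< n → n ∣ n C k) →
  ∀ i → + n ℤ∣.∣ (i ℤ.+ 1ℤ) ℤ.^ n ℤ.- (i ℤ.^ n ℤ.+ 1ℤ)
frobenius n@(suc q) n∣nCk i = subst (+ n ℤ∣.∣_) (sym (begin
  (i ℤ.+ 1ℤ) ℤ.^ n ℤ.- (i ℤ.^ n ℤ.+ 1ℤ)
    ≡⟨ cong (ℤ._- (i ℤ.^ n ℤ.+ 1ℤ)) (trans (sym (^ᴿ≡^ (i ℤ.+ 1ℤ) n)) (Binomial.theorem n i 1ℤ)) ⟩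
  term zero ℤ.+ sum (term ∘ suc) ℤ.- (i ℤ.^ n ℤ.+ 1ℤ)
    ≡⟨ cong (λ t → term zero ℤ.+ t ℤ.- (i ℤ.^ n ℤ.+ 1ℤ)) (sum-init-last (term ∘ suc)) ⟩
  term zero ℤ.+ (middle ℤ.+ term (suc (Fin.fromℕ q))) ℤ.- (i ℤ.^ n ℤ.+ 1ℤ)
    ≡⟨ cong₂ (λ s t → s ℤ.+ (middle ℤ.+ t) ℤ.- (i ℤ.^ n ℤ.+ 1ℤ)) first last ⟩
  1ℤ ℤ.+ (middle ℤ.+ i ℤ.^ n) ℤ.- (i ℤ.^ n ℤ.+ 1ℤ)
    ≡⟨ lemma middle (i ℤ.^ n) ⟩
  middle ∎)) (∣-sum (term ∘ suc ∘ inject₁) n∣term)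
  where
  open ≡-Reasoning
  term : Fin (suc n) → ℤ
  term = Binomial.binomialTerm i 1ℤ n
  middle = sum (term ∘ suc ∘ inject₁)
  1^ᴿ : ∀ m → 1ℤ ^ᴿ m ≡ 1ℤ
  1^ᴿ m = trans (^ᴿ≡^ 1ℤ m) (ℤ.^-zeroˡ m)
  term≡ : ∀ k → term k ≡ + (n C toℕ k) ℤ.* i ℤ.^ toℕ k
  term≡ k = trans (×≡* (n C toℕ k) _) (cong (+ (n C toℕ k) ℤ.*_) (begin
    i ^ᴿ toℕ k ℤ.* 1ℤ ^ᴿ (n ℕ.∸ toℕ k)   ≡⟨ cong₂ ℤ._*_ (^ᴿ≡^ i (toℕ k)) (1^ᴿ (n ℕ.∸ toℕ k)) ⟩
    i ℤ.^ toℕ k ℤ.* 1ℤ                    ≡⟨ ℤ.*-identityʳ (i ℤ.^ toℕ k) ⟩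
    i ℤ.^ toℕ k                           ∎))
  first : term zero ≡ 1ℤ
  first = term≡ zero
  last : term (suc (Fin.fromℕ q)) ≡ i ℤ.^ n
  last = begin
    term (suc (Fin.fromℕ q))    ≡⟨ term≡ (suc (Fin.fromℕ q)) ⟩
    _                           ≡⟨ cong (λ k → + (n C suc k) ℤ.* i ℤ.^ suc k) (Fin.toℕ-fromℕ q) ⟩
    + (n C n) ℤ.* i ℤ.^ n       ≡⟨ cong (λ c → + c ℤ.* i ℤ.^ n) (nCn≡1 n) ⟩
    1ℤ ℤ.* i ℤ.^ n              ≡⟨ ℤ.*-identityˡ (i ℤ.^ n) ⟩
    i ℤ.^ n                     ∎
  n∣term : ∀ k → + n ℤ∣.∣ term (suc (inject₁ k))
  n∣term k = subst (+ n ℤ∣.∣_) (sym (term≡ (suc (inject₁ k))))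
    (ℤ∣.∣m⇒∣m*n {m = + (n C suc (toℕ (inject₁ k)))} (i ℤ.^ toℕ (suc (inject₁ k))) (ℤ∣.∣ᵤ⇒∣ (n∣nCk (s≤s z≤n)
      (s≤s (subst (ℕ._< q) (sym (Fin.toℕ-inject₁ k)) (Fin.toℕ<n k))))))
  lemma : ∀ m t → 1ℤ ℤ.+ (m ℤ.+ t) ℤ.- (t ℤ.+ 1ℤ) ≡ m
  lemma = ℤ-solver.solve-∀

module _ {p : ℕ} (p-prime : Prime p) where

  private instance
    p≢0 = prime⇒nonZero p-prime
    p-nonTrivial = prime⇒nonTrivial p-prime

  p∤1 : ¬ p ∣ 1
  p∤1 = ℕ∣.>⇒∤ (ℕ.nonTrivial⇒n>1 p)

  ∣-*⇒ : ∀ i j → + p ℤ∣.∣ i ℤ.* j → + p ℤ∣.∣ i ⊎ + p ℤ∣.∣ j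
  ∣-*⇒ i j p∣ij = Sum.map ℤ∣.∣ᵤ⇒∣ ℤ∣.∣ᵤ⇒∣
    (euclidsLemma ℤ.∣ i ∣ ℤ.∣ j ∣ p-prime (subst (p ∣_) (ℤ.abs-* i j) (ℤ∣.∣⇒∣ᵤ p∣ij)))

  -- Lagrange's argument: after division by x - r, with r the first root, p divides (root - r) times
  -- the quotient at each other root. Incongruence rules out the first factor, and the degree drops.
  -- It ends at the monic polynomial of degree 0, the constant 1, which p does not divide.
  too-many-roots : ∀ {n} (cs : Vec ℤ n) (root : Fin (suc n) → ℤ) →
    (∀ i j → + p ℤ∣.∣ root i ℤ.- root j → i ≡ j) → ¬ (∀ i → + p ℤ∣.∣ ⟦ cs ⟧ (root i))
  too-many-roots [] root inj p∣ = p∤1 (ℤ∣.∣⇒∣ᵤ (p∣ zero))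
  too-many-roots cs@(_ ∷ _) root inj p∣ = too-many-roots (deflate cs r) (root ∘ suc)
    (λ i j → Fin.suc-injective ∘ inj (suc i) (suc j)) p∣deflated
    where
    r = root zero
    p∣deflated : ∀ i → + p ℤ∣.∣ ⟦ deflate cs r ⟧ (root (suc i))
    p∣deflated i with ∣-*⇒ (root (suc i) ℤ.- r) (⟦ deflate cs r ⟧ (root (suc i)))
      (subst (+ p ℤ∣.∣_) (deflate-correct cs (root (suc i)) r) (ℤ∣.∣m∣n⇒∣m-n (p∣ (suc i)) (p∣ zero)))
    ... | inj₁ p∣diff = contradiction (inj (suc i) zero p∣diff) λ ()
    ... | inj₂ p∣q    = p∣q

  -- By absorption p divides k times the coefficient, and p cannot divide k since 0 < k < p.
  p∣pCk : ∀ {k} → 0 ℕ.< k → k ℕ.< p → p ∣ p C k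
  p∣pCk {suc k} _ k<p with euclidsLemma (suc k) (p C suc k) p-prime (lemma p)
    where
    lemma : ∀ n .{{_ : NonZero n}} → n ∣ suc k ℕ.* (n C suc k)
    lemma (suc n) = subst (suc n ∣_) (sym (C-absorb n k)) (ℕ∣.m∣m*n (n C k))
  ... | inj₁ p∣k = contradiction p∣k (ℕ∣.>⇒∤ k<p)
  ... | inj₂ p∣C = p∣C

  n^p≡n : ∀ n → + p ℤ∣.∣ (+ n) ℤ.^ p ℤ.- + n
  n^p≡n zero    = subst (λ t → + p ℤ∣.∣ t ℤ.- 0ℤ) (sym (0^n p)) (ℤ∣.divides 0ℤ refl)
    where
    0^n : ∀ n .{{_ : NonZero n}} → 0ℤ ℤ.^ n ≡ 0ℤ
    0^n (suc n) = refl
  n^p≡n (suc n) = subst (λ t → + p ℤ∣.∣ t ℤ.^ p ℤ.- t) (ℤ.+-comm (+ n) 1ℤ)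
    (∣-trans ((+ n ℤ.+ 1ℤ) ℤ.^ p) ((+ n) ℤ.^ p ℤ.+ 1ℤ) (+ n ℤ.+ 1ℤ)
      (frobenius p p∣pCk (+ n))
      (subst (+ p ℤ∣.∣_) (lemma ((+ n) ℤ.^ p) (+ n)) (n^p≡n n)))
    where
    lemma : ∀ a b → a ℤ.- b ≡ (a ℤ.+ 1ℤ) ℤ.- (b ℤ.+ 1ℤ)
    lemma = ℤ-solver.solve-∀

  fermat : ∀ {n q} → p ≡ suc q → ¬ p ∣ n → + p ℤ∣.∣ (+ n) ℤ.^ q ℤ.- 1ℤ
  fermat {n} {q} p≡1+q p∤n with ∣-*⇒ (+ n) ((+ n) ℤ.^ q ℤ.- 1ℤ)
    (subst (+ p ℤ∣.∣_) (trans (cong (λ m → (+ n) ℤ.^ m ℤ.- + n) p≡1+q) (lemma (+ n) ((+ n) ℤ.^ q))) (n^p≡n n))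
    where
    lemma : ∀ a b → a ℤ.* b ℤ.- a ≡ a ℤ.* (b ℤ.- 1ℤ)
    lemma = ℤ-solver.solve-∀
  ... | inj₁ p∣n = contradiction (ℤ∣.∣⇒∣ᵤ p∣n) p∤n
  ... | inj₂ p∣  = p∣

  module _ {h : ℕ} (p≡1+2h : p ≡ suc (2 ℕ.* h)) where

    private
      h<p : h ℕ.< p
      h<p = subst (h ℕ.<_) (sym p≡1+2h) (s≤s (ℕ.m≤m+n h _))

      ^2h : ∀ i → (i ℤ.* i) ℤ.^ h ≡ i ℤ.^ (2 ℕ.* h)
      ^2h i = trans (cong (ℤ._^ h) (cong (i ℤ.*_) (sym (ℤ.^-identityʳ i)))) (ℤ.^-*-assoc i 2 h)

      square^h : ∀ {n} → ¬ p ∣ n → + p ℤ∣.∣ (+ n ℤ.* + n) ℤ.^ h ℤ.- 1ℤ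
      square^h {n} p∤n = subst (λ t → + p ℤ∣.∣ t ℤ.- 1ℤ) (sym (^2h (+ n))) (fermat p≡1+2h p∤n)

      1≤h : 0 ℕ.< h
      1≤h = ℕ.n≢0⇒n>0 λ { refl → p∤1 (subst (p ∣_) p≡1+2h ℕ∣.∣-refl) }

      0<s<p⇒p∤s : ∀ {s} → 0 ℕ.< s → s ℕ.< p → ¬ p ∣ s
      0<s<p⇒p∤s {suc s} _ s<p = ℕ∣.>⇒∤ s<p

      square : Fin h → ℤ
      square i = + suc (toℕ i) ℤ.* + suc (toℕ i)

      1+i<p : (i : Fin h) → suc (toℕ i) ℕ.< p
      1+i<p i = ℕ.≤-<-trans (Fin.toℕ<n i) h<p

      -- The numbers a and b lie in 1, ..., h, so 0 < a + b ≤ 2h < p. Hence p must divide a - b,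
      -- which is smaller than p in absolute value.
      square-injective : ∀ i j → + p ℤ∣.∣ square i ℤ.- square j → i ≡ j
      square-injective i j p∣ with ∣-*⇒ (a ℤ.- b) (a ℤ.+ b) (subst (+ p ℤ∣.∣_) (lemma a b) p∣)
        where
        a = + suc (toℕ i)
        b = + suc (toℕ j)
        lemma : ∀ a b → a ℤ.* a ℤ.- b ℤ.* b ≡ (a ℤ.- b) ℤ.* (a ℤ.+ b)
        lemma = ℤ-solver.solve-∀
      ... | inj₁ p∣a-b = Fin.toℕ-injective (ℕ.∣m-n∣≡0⇒m≡n
        (∣∧<⇒≡0 (⇒∣-∣ (suc (toℕ i)) (suc (toℕ j)) p∣a-b)
          (ℕ.≤-<-trans (ℕ.∣m-n∣≤m⊔n (suc (toℕ i)) (suc (toℕ j))) (ℕ.⊔-pres-<m (1+i<p i) (1+i<p j)))))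
      ... | inj₂ p∣a+b = contradiction (ℤ∣.∣⇒∣ᵤ p∣a+b) (0<s<p⇒p∤s (s≤s z≤n) (begin-strict
        suc (toℕ i) ℕ.+ suc (toℕ j)   ≤⟨ ℕ.+-mono-≤ (Fin.toℕ<n i) (Fin.toℕ<n j) ⟩
        h ℕ.+ h                       ≡⟨ cong (h ℕ.+_) (ℕ.+-identityʳ h) ⟨
        2 ℕ.* h                       <⟨ ℕ.n<1+n (2 ℕ.* h) ⟩
        suc (2 ℕ.* h)                 ≡⟨ p≡1+2h ⟨
        p                             ∎))
        where open ℕ.≤-Reasoning

    -- The squares 1², …, h² are already h roots of xʰ - 1 modulo p, so a
    -- non-residue is not a root.
    nonresidue^h≢1 : (r : Fin p) → ¬ QuadraticResidue r → ¬ (+ p ℤ∣.∣ (+ toℕ r) ℤ.^ h ℤ.- 1ℤ)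
    nonresidue^h≢1 r ¬qr p∣ = too-many-roots (xᵐ-1 h) root root-injective λ i →
      subst (+ p ℤ∣.∣_) (sym (⟦xᵐ-1⟧ h 1≤h (root i))) (p∣root^h-1 i)
      where
      root : Fin (suc h) → ℤ
      root zero    = + toℕ r
      root (suc i) = square i
      p∣root^h-1 : ∀ i → + p ℤ∣.∣ root i ℤ.^ h ℤ.- 1ℤ
      p∣root^h-1 zero    = p∣
      p∣root^h-1 (suc i) = square^h (0<s<p⇒p∤s (s≤s z≤n) (1+i<p i))
      square≢r : ∀ i → ¬ (+ p ℤ∣.∣ square i ℤ.- + toℕ r)
      square≢r i p∣s-r = ¬qr (fromℕ< (1+i<p i) , subst (λ s → p ∣ ℕ.∣ s ℕ.* s - toℕ r ∣)
        (sym (Fin.toℕ-fromℕ< (1+i<p i)))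
        (⇒∣-∣ (suc (toℕ i) ℕ.* suc (toℕ i)) (toℕ r)
          (subst (λ s → + p ℤ∣.∣ s ℤ.- + toℕ r) (sym (ℤ.pos-* (suc (toℕ i)) (suc (toℕ i)))) p∣s-r)))
      root-injective : ∀ i j → + p ℤ∣.∣ root i ℤ.- root j → i ≡ j
      root-injective zero    zero    _ = refl
      root-injective zero    (suc j) d = contradiction (∣-sym {i = + toℕ r} {square j} d) (square≢r j)
      root-injective (suc i) zero    d = contradiction d (square≢r i)
      root-injective (suc i) (suc j) d = cong suc (square-injective i j d)

    -- A residue y² has h-th power y²ʰ, which is 1 by Fermat. For a nonzero non-residue, p divides
    -- (rʰ - 1)(rʰ + 1), and counting roots excludes the first factor. The case r = 0 relies on h
    -- being positive.
    euler-criterion : (r : Fin p) → + p ℤ∣.∣ legendre r ℤ.- (+ toℕ r) ℤ.^ h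
    euler-criterion r = legendre-elim (λ l → + p ℤ∣.∣ l ℤ.- a) r zero-case residue-case nonresidue-case
      where
      a = (+ toℕ r) ℤ.^ h

      zero-case : toℕ r ≡ 0 → + p ℤ∣.∣ 0ℤ ℤ.- a
      zero-case r≡0 = subst (λ t → + p ℤ∣.∣ 0ℤ ℤ.- t) (sym 0^h≡0) (ℤ∣.divides 0ℤ refl)
        where
        0^n : ∀ {n} → 0 ℕ.< n → 0ℤ ℤ.^ n ≡ 0ℤ
        0^n (s≤s _) = refl
        0^h≡0 : a ≡ 0ℤ
        0^h≡0 = trans (cong (λ n → (+ n) ℤ.^ h) r≡0) (0^n 1≤h)

      residue-case : toℕ r ≢ 0 → QuadraticResidue r → + p ℤ∣.∣ 1ℤ ℤ.- a
      residue-case r≢0 (y , p∣) =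
        ∣-trans 1ℤ ((+ toℕ y ℤ.* + toℕ y) ℤ.^ h) a
          (∣-sym {i = (+ toℕ y ℤ.* + toℕ y) ℤ.^ h} {1ℤ} (square^h p∤y))
          (∣-^-cong (+ toℕ y ℤ.* + toℕ y) (+ toℕ r) h y²≡r)
        where
        y²≡r : + p ℤ∣.∣ + toℕ y ℤ.* + toℕ y ℤ.- + toℕ r
        y²≡r = subst (λ s → + p ℤ∣.∣ s ℤ.- + toℕ r) (ℤ.pos-* (toℕ y) (toℕ y))
          (∣-∣⇒ (toℕ y ℕ.* toℕ y) (toℕ r) p∣)
        lemma : ∀ s r → s ℤ.- (s ℤ.- r) ≡ r
        lemma = ℤ-solver.solve-∀
        -- If p divided y it would divide both y² and y² - r, hence r, which is a nonzero
        -- representative below p.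
        p∤y : ¬ p ∣ toℕ y
        p∤y p∣y = r≢0 (∣∧<⇒≡0 (ℤ∣.∣⇒∣ᵤ (subst (+ p ℤ∣.∣_) (lemma (+ toℕ y ℤ.* + toℕ y) (+ toℕ r))
          (ℤ∣.∣m∣n⇒∣m-n (ℤ∣.∣m⇒∣m*n (+ toℕ y) (ℤ∣.∣ᵤ⇒∣ {+ p} {+ toℕ y} p∣y)) y²≡r))) (Fin.toℕ<n r))

      nonresidue-case : toℕ r ≢ 0 → ¬ QuadraticResidue r → + p ℤ∣.∣ -1ℤ ℤ.- a
      nonresidue-case r≢0 ¬qr = Sum.[ (λ p∣a-1 → contradiction p∣a-1 (nonresidue^h≢1 r ¬qr))
                                    , (λ p∣a+1 → subst (+ p ℤ∣.∣_) (lemma₂ a) (ℤ∣.∣m⇒∣-m p∣a+1)) ]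
        (∣-*⇒ (a ℤ.- 1ℤ) (a ℤ.+ 1ℤ) (subst (+ p ℤ∣.∣_) factor (fermat p≡1+2h p∤r)))
        where
        p∤r : ¬ p ∣ toℕ r
        p∤r p∣r = r≢0 (∣∧<⇒≡0 p∣r (Fin.toℕ<n r))
        lemma₁ : ∀ a → a ℤ.* a ℤ.- 1ℤ ≡ (a ℤ.- 1ℤ) ℤ.* (a ℤ.+ 1ℤ)
        lemma₁ = ℤ-solver.solve-∀
        lemma₂ : ∀ a → ℤ.- (a ℤ.+ 1ℤ) ≡ -1ℤ ℤ.- a
        lemma₂ = ℤ-solver.solve-∀
        factor : (+ toℕ r) ℤ.^ (2 ℕ.* h) ℤ.- 1ℤ ≡ (a ℤ.- 1ℤ) ℤ.* (a ℤ.+ 1ℤ)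
        factor = trans (cong (ℤ._- 1ℤ) (trans (cong ((+ toℕ r) ℤ.^_) (cong (h ℕ.+_) (ℕ.+-identityʳ h)))
          (ℤ.^-distribˡ-+-* (+ toℕ r) h h))) (lemma₁ a)

-- Reduction of the coefficients modulo p

-- An extra factor m + 1 leaves room to absorb twice, once from 2m + 2 to 2m + 1 and once from 2m +
-- 1 to 2m. Between the two, the symmetry of row 2m + 1 restores the lower index m + 1.
centralBinomial-suc : ∀ m → suc m ℕ.* ((2 ℕ.* suc m) C suc m) ≡ 2 ℕ.* suc (2 ℕ.* m) ℕ.* ((2 ℕ.* m) C m)
centralBinomial-suc m = ℕ.*-cancelˡ-≡ _ _ (suc m) (begin
  suc m ℕ.* (suc m ℕ.* ((2 ℕ.* suc m) C suc m))
    ≡⟨ cong (λ n → suc m ℕ.* (suc m ℕ.* (n C suc m))) (ℕ.*-suc 2 m) ⟩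
  suc m ℕ.* (suc m ℕ.* (suc (suc (2 ℕ.* m)) C suc m))
    ≡⟨ cong (suc m ℕ.*_) (C-absorb (suc (2 ℕ.* m)) m) ⟩
  suc m ℕ.* (suc (suc (2 ℕ.* m)) ℕ.* (suc (2 ℕ.* m) C m))
    ≡⟨ rearrange₁ (suc m) (suc (suc (2 ℕ.* m))) (suc (2 ℕ.* m) C m) ⟩
  suc (suc (2 ℕ.* m)) ℕ.* (suc m ℕ.* (suc (2 ℕ.* m) C m))
    ≡⟨ cong (λ c → suc (suc (2 ℕ.* m)) ℕ.* (suc m ℕ.* c)) symmetric ⟩
  suc (suc (2 ℕ.* m)) ℕ.* (suc m ℕ.* (suc (2 ℕ.* m) C suc m))
    ≡⟨ cong (suc (suc (2 ℕ.* m)) ℕ.*_) (C-absorb (2 ℕ.* m) m) ⟩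
  suc (suc (2 ℕ.* m)) ℕ.* (suc (2 ℕ.* m) ℕ.* ((2 ℕ.* m) C m))
    ≡⟨ rearrange₂ m ((2 ℕ.* m) C m) ⟩
  suc m ℕ.* (2 ℕ.* suc (2 ℕ.* m) ℕ.* ((2 ℕ.* m) C m)) ∎)
  where
  open ≡-Reasoning
  rearrange₁ : ∀ a b c → a ℕ.* (b ℕ.* c) ≡ b ℕ.* (a ℕ.* c)
  rearrange₁ = ℕ-solver.solve-∀
  rearrange₂ : ∀ m c → suc (suc (2 ℕ.* m)) ℕ.* (suc (2 ℕ.* m) ℕ.* c) ≡ suc m ℕ.* (2 ℕ.* suc (2 ℕ.* m) ℕ.* c)
  rearrange₂ = ℕ-solver.solve-∀
  symmetric : suc (2 ℕ.* m) C m ≡ suc (2 ℕ.* m) C suc m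
  symmetric = trans (nCk≡nC[n∸k] (ℕ.m≤n⇒m≤1+n (ℕ.m≤m+n m _)))
    (cong (suc (2 ℕ.* m) C_) (trans (ℕ.+-∸-assoc 1 (ℕ.m≤m+n m (m ℕ.+ 0)))
      (cong suc (trans (ℕ.m+n∸m≡n m (m ℕ.+ 0)) (ℕ.+-identityʳ m)))))

-4ℤ : ℤ
-4ℤ = ℤ.- + 4

-- Modulo p = 2h + 1 one has C(2m,m) = (-4)ᵐ C(-1/2,m) and -1/2 ≡ h.
centralBinomial-mod : ∀ {p h} → Prime p → p ≡ suc (2 ℕ.* h) → ∀ {m} → m ℕ.≤ h →
  + p ℤ∣.∣ + ((2 ℕ.* m) C m) ℤ.- -4ℤ ℤ.^ m ℤ.* + (h C m)
centralBinomial-mod pr refl {zero} m≤h = ℤ∣.divides 0ℤ refl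
-- The recurrences give the congruence multiplied by m + 1, which can be cancelled because m + 1 ≤ h
-- < p.
centralBinomial-mod {p} {h} pr refl {suc m} m<h = Sum.[
    (λ p∣m+1 → contradiction (ℤ∣.∣⇒∣ᵤ p∣m+1) (ℕ∣.>⇒∤ (s≤s (ℕ.≤-trans m<h (ℕ.m≤m+n h _))))) , (λ p∣ → p∣) ]
  (∣-*⇒ pr (+ suc m) (+ D′ ℤ.- -4ℤ ℤ.^ suc m ℤ.* + C′) (subst (+ p ℤ∣.∣_) (sym main)
    (ℤ∣.∣m∣n⇒∣m+n (ℤ∣.∣n⇒∣m*n (+ 2 ℤ.* (1ℤ ℤ.+ + 2 ℤ.* + m)) (centralBinomial-mod pr refl {m} (ℕ.<⇒≤ m<h)))
      (ℤ∣.∣n⇒∣m*n (+ 2 ℤ.* e ℤ.* + C₀) (ℤ∣.∣-reflexive 1+2h)))))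
  where
  D₀ = (2 ℕ.* m) C m
  D′ = (2 ℕ.* suc m) C suc m
  C₀ = h C m
  C′ = h C suc m
  e = -4ℤ ℤ.^ m
  1+2h : + suc (2 ℕ.* h) ≡ 1ℤ ℤ.+ + 2 ℤ.* + h
  1+2h = trans (ℤ.pos-+ 1 (2 ℕ.* h)) (cong (λ t → 1ℤ ℤ.+ t) (ℤ.pos-* 2 h))
  D-suc : + suc m ℤ.* + D′ ≡ + 2 ℤ.* (1ℤ ℤ.+ + 2 ℤ.* + m) ℤ.* + D₀
  D-suc = begin
    + suc m ℤ.* + D′                              ≡⟨ ℤ.pos-* (suc m) D′ ⟨
    + (suc m ℕ.* D′)                              ≡⟨ cong +_ (centralBinomial-suc m) ⟩
    + (2 ℕ.* suc (2 ℕ.* m) ℕ.* D₀)                ≡⟨ ℤ.pos-* (2 ℕ.* suc (2 ℕ.* m)) D₀ ⟩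
    + (2 ℕ.* suc (2 ℕ.* m)) ℤ.* + D₀              ≡⟨ cong (ℤ._* + D₀) (ℤ.pos-* 2 (suc (2 ℕ.* m))) ⟩
    + 2 ℤ.* + suc (2 ℕ.* m) ℤ.* + D₀              ≡⟨ cong (λ t → + 2 ℤ.* (1ℤ ℤ.+ t) ℤ.* + D₀) (ℤ.pos-* 2 m) ⟩
    + 2 ℤ.* (1ℤ ℤ.+ + 2 ℤ.* + m) ℤ.* + D₀         ∎
    where open ≡-Reasoning
  -- Pascal's rule and absorption in place of (m+1) C(h,m+1) = (h-m) C(h,m), so that no subtraction
  -- in ℕ occurs.
  C-suc : (1ℤ ℤ.+ + m) ℤ.* (+ C₀ ℤ.+ + C′) ≡ (1ℤ ℤ.+ + h) ℤ.* + C₀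
  C-suc = begin
    (1ℤ ℤ.+ + m) ℤ.* (+ C₀ ℤ.+ + C′)      ≡⟨ ℤ.pos-* (suc m) (C₀ ℕ.+ C′) ⟨
    + (suc m ℕ.* (C₀ ℕ.+ C′))             ≡⟨ cong (λ c → + (suc m ℕ.* c)) (nCk+nC[k+1]≡[n+1]C[k+1] h m) ⟩
    + (suc m ℕ.* (suc h C suc m))         ≡⟨ cong +_ (C-absorb h m) ⟩
    + (suc h ℕ.* C₀)                      ≡⟨ ℤ.pos-* (suc h) C₀ ⟩
    (1ℤ ℤ.+ + h) ℤ.* + C₀                 ∎
    where open ≡-Reasoning
  -- The two recurrences have factors 2(2m+1) and -4(h-m). Their difference is 2(2m+1) + 4(h-m) =
  -- 2(2h+1), a multiple of p.
  main : + suc m ℤ.* (+ D′ ℤ.- -4ℤ ℤ.^ suc m ℤ.* + C′) ≡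
    + 2 ℤ.* (1ℤ ℤ.+ + 2 ℤ.* + m) ℤ.* (+ D₀ ℤ.- e ℤ.* + C₀) ℤ.+ + 2 ℤ.* e ℤ.* + C₀ ℤ.* (1ℤ ℤ.+ + 2 ℤ.* + h)
  main = begin
    (1ℤ ℤ.+ + m) ℤ.* (+ D′ ℤ.- -4ℤ ℤ.* e ℤ.* + C′)
      ≡⟨ lemma₁ (+ m) (+ D′) e (+ C₀) (+ C′) ⟩
    (1ℤ ℤ.+ + m) ℤ.* + D′ ℤ.+ + 4 ℤ.* e ℤ.* ((1ℤ ℤ.+ + m) ℤ.* (+ C₀ ℤ.+ + C′) ℤ.- (1ℤ ℤ.+ + m) ℤ.* + C₀)
      ≡⟨ cong₂ (λ s t → s ℤ.+ + 4 ℤ.* e ℤ.* (t ℤ.- (1ℤ ℤ.+ + m) ℤ.* + C₀)) D-suc C-suc ⟩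
    + 2 ℤ.* (1ℤ ℤ.+ + 2 ℤ.* + m) ℤ.* + D₀ ℤ.+ + 4 ℤ.* e ℤ.* ((1ℤ ℤ.+ + h) ℤ.* + C₀ ℤ.- (1ℤ ℤ.+ + m) ℤ.* + C₀)
      ≡⟨ lemma₂ (+ m) (+ h) (+ D₀) e (+ C₀) ⟩
    _ ∎
    where
    open ≡-Reasoning
    lemma₁ : ∀ m d e c c′ → (1ℤ ℤ.+ m) ℤ.* (d ℤ.- (ℤ.- + 4) ℤ.* e ℤ.* c′) ≡
      (1ℤ ℤ.+ m) ℤ.* d ℤ.+ + 4 ℤ.* e ℤ.* ((1ℤ ℤ.+ m) ℤ.* (c ℤ.+ c′) ℤ.- (1ℤ ℤ.+ m) ℤ.* c)
    lemma₁ = ℤ-solver.solve-∀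
    lemma₂ : ∀ m h d e c → + 2 ℤ.* (1ℤ ℤ.+ + 2 ℤ.* m) ℤ.* d ℤ.+ + 4 ℤ.* e ℤ.* ((1ℤ ℤ.+ h) ℤ.* c ℤ.- (1ℤ ℤ.+ m) ℤ.* c) ≡
      + 2 ℤ.* (1ℤ ℤ.+ + 2 ℤ.* m) ℤ.* (d ℤ.- e ℤ.* c) ℤ.+ + 2 ℤ.* e ℤ.* c ℤ.* (1ℤ ℤ.+ + 2 ℤ.* h)
    lemma₂ = ℤ-solver.solve-∀

n∸2k≡[n∸k]∸k : ∀ n k → n ℕ.∸ 2 ℕ.* k ≡ n ℕ.∸ k ℕ.∸ k
n∸2k≡[n∸k]∸k n k = trans (cong (λ l → n ℕ.∸ (k ℕ.+ l)) (ℕ.+-identityʳ k)) (sym (ℕ.∸-+-assoc n k k))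

-- The second binomial has lower index n - 2k because it is the coefficient of tⁿ⁻²ᵏ in (1 + wt)ⁿ⁻ᵏ,
-- the form in which `centralTrinomial` produces it.
legendreCoeff≡ : ∀ n k → 2 ℕ.* k ℕ.≤ n →
  legendreCoeff n k ≡ fromℤ (-1ℤ ℤ.^ k ℤ.* + (((2 ℕ.* (n ℕ.∸ k)) C (n ℕ.∸ k)) ℕ.* ((n ℕ.∸ k) C (n ℕ.∸ 2 ℕ.* k))))
legendreCoeff≡ n k 2k≤n = trans
  (cong (λ i → (i / d) {{d≢0}}) numerator≡)
  (/-cancel (-1ℤ ℤ.^ k ℤ.* + (D ℕ.* c)) d {{d≢0}})
  where
  open ≡-Reasoning
  m = n ℕ.∸ k
  l = n ℕ.∸ 2 ℕ.* k
  D = (2 ℕ.* m) C m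
  c = m C l
  d = k ! ℕ.* m ! ℕ.* l !
  d≢0 : ℕ.NonZero d
  d≢0 = ℕ.m*n≢0 (k ! ℕ.* m !) (l !) {{k ℕ.!* m !≢0}} {{l ℕ.!≢0}}
  k≤m : k ℕ.≤ m
  k≤m = ℕ.m+n≤o⇒m≤o∸n k (subst (ℕ._≤ n) (cong (k ℕ.+_) (ℕ.+-identityʳ k)) 2k≤n)
  l≡m∸k : l ≡ m ℕ.∸ k
  l≡m∸k = n∸2k≡[n∸k]∸k n k
  m! : m ! ≡ c ℕ.* (k ! ℕ.* l !)
  m! = begin
    m !                                          ≡⟨ C*k!*[n∸k]! k≤m ⟨
    (m C k) ℕ.* (k ! ℕ.* (m ℕ.∸ k) !)            ≡⟨ cong₂ (λ a b → a ℕ.* (k ! ℕ.* b !)) (nCk≡nC[n∸k] k≤m) (sym l≡m∸k) ⟩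
    (m C (m ℕ.∸ k)) ℕ.* (k ! ℕ.* l !)            ≡⟨ cong (λ a → (m C a) ℕ.* (k ! ℕ.* l !)) l≡m∸k ⟨
    c ℕ.* (k ! ℕ.* l !)                          ∎
  [2m]! : (2 ℕ.* m) ! ≡ D ℕ.* (m ! ℕ.* m !)
  [2m]! = trans (sym (C*k!*[n∸k]! (ℕ.m≤m+n m (m ℕ.+ 0))))
    (cong (λ a → D ℕ.* (m ! ℕ.* a !)) (trans (ℕ.m+n∸m≡n m (m ℕ.+ 0)) (ℕ.+-identityʳ m)))
  rearrange : ∀ D m c k l → D ℕ.* (m ℕ.* (c ℕ.* (k ℕ.* l))) ≡ (D ℕ.* c) ℕ.* (k ℕ.* m ℕ.* l)
  rearrange = ℕ-solver.solve-∀
  factorials : (2 ℕ.* n ℕ.∸ 2 ℕ.* k) ! ≡ (D ℕ.* c) ℕ.* d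
  factorials = begin
    (2 ℕ.* n ℕ.∸ 2 ℕ.* k) !                      ≡⟨ cong _! (ℕ.*-distribˡ-∸ 2 n k) ⟨
    (2 ℕ.* m) !                                  ≡⟨ [2m]! ⟩
    -- Only one of the two factors m! is expanded; the other is the (n-k)! of the denominator.
    D ℕ.* (m ! ℕ.* m !)                          ≡⟨ cong (λ a → D ℕ.* (m ! ℕ.* a)) m! ⟩
    D ℕ.* (m ! ℕ.* (c ℕ.* (k ! ℕ.* l !)))        ≡⟨ rearrange D (m !) c (k !) (l !) ⟩
    (D ℕ.* c) ℕ.* d                              ∎
  numerator≡ : -1ℤ ℤ.^ k ℤ.* + ((2 ℕ.* n ℕ.∸ 2 ℕ.* k) !) ≡ -1ℤ ℤ.^ k ℤ.* + (D ℕ.* c) ℤ.* + d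
  numerator≡ = begin
    -1ℤ ℤ.^ k ℤ.* + ((2 ℕ.* n ℕ.∸ 2 ℕ.* k) !)    ≡⟨ cong (λ a → -1ℤ ℤ.^ k ℤ.* + a) factorials ⟩
    -1ℤ ℤ.^ k ℤ.* + ((D ℕ.* c) ℕ.* d)            ≡⟨ cong (-1ℤ ℤ.^ k ℤ.*_) (ℤ.pos-* (D ℕ.* c) d) ⟩
    -1ℤ ℤ.^ k ℤ.* (+ (D ℕ.* c) ℤ.* + d)          ≡⟨ ℤ.*-assoc (-1ℤ ℤ.^ k) (+ (D ℕ.* c)) (+ d) ⟨
    -1ℤ ℤ.^ k ℤ.* + (D ℕ.* c) ℤ.* + d            ∎

-- The two sides of the congruence for p = 2h + 1

1^ : ∀ n → 1ℚ ^ n ≡ 1ℚ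
1^ zero    = refl
1^ (suc n) = trans (ℚ.*-identityˡ (1ℚ ^ n)) (1^ n)

^2* : ∀ x k → x ^ (2 ℕ.* k) ≡ x ^ k * x ^ k
^2* x k = trans (cong (λ l → x ^ (k ℕ.+ l)) (ℕ.+-identityʳ k)) (^-homo-* x k k)

private module _ {p h : ℕ} (p-prime : Prime p) (p≡1+2h : p ≡ suc (2 ℕ.* h)) where

  2⊥p : Coprime 2 p
  2⊥p = prime∤⇒coprime p-prime (ℕ∣.>⇒∤ (ℕ.≤∧≢⇒< (ℕ.nonTrivial⇒n>1 p) 2≢p))
    where
    instance _ = prime⇒nonTrivial p-prime
    2≢p : 2 ≢ p
    2≢p 2≡p = ℕ.even≢odd 1 h (trans 2≡p p≡1+2h)

  ½∈ : ½ ∈ℤ₍ p ₎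
  ½∈ = 2⊥p

  ¼∈ : (+ 1 / 4) ∈ℤ₍ p ₎
  ¼∈ = coprime-* 2⊥p 2⊥p

  centralBinomial≡ : ∀ {m} → m ℕ.≤ h →
    fromℕ ((2 ℕ.* m) C m) ≡ fromℤ -4ℤ ^ m * fromℕ (h C m) [mod p ]
  centralBinomial≡ {m} m≤h = subst (fromℕ ((2 ℕ.* m) C m) ≡_[mod p ])
    (trans (fromℤ-* (-4ℤ ℤ.^ m) (+ (h C m))) (cong (_* fromℕ (h C m)) (fromℤ-^ -4ℤ m)))
    (fromℤ-cong-mod {i = + ((2 ℕ.* m) C m)} { -4ℤ ℤ.^ m ℤ.* + (h C m)} (centralBinomial-mod p-prime p≡1+2h m≤h))

  -- The binomial is squared, so (-4)ᵏ contributes 16ᵏ, which exactly cancels the (1/4)²ᵏ from x/4.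
  sum-term≡ : ∀ {x} → x ∈ℤ₍ p ₎ → ∀ {k} → k ℕ.≤ h →
    fromℕ ((2 ℕ.* k) C k) ^ 2 * (x * (+ 1 / 4)) ^ (2 ℕ.* k) ≡ fromℕ (h C k) ^ 2 * x ^ (2 ℕ.* k) [mod p ]
  sum-term≡ {x} x∈ {k} k≤h = subst (_ ≡_[mod p ]) simplify
    (*-cong-mod (^-cong-mod 2 (centralBinomial≡ k≤h)) (≡mod-refl (^∈ (x * (+ 1 / 4)) (2 ℕ.* k) (*∈ x (+ 1 / 4) x∈ ¼∈))))
    where
    open ≡-Reasoning
    a = fromℤ -4ℤ
    q = + 1 / 4
    c = fromℕ (h C k)
    aq≡1 : a ^ k * (a ^ k * (q ^ k * q ^ k)) ≡ 1ℚ
    aq≡1 = begin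
      a ^ k * (a ^ k * (q ^ k * q ^ k))   ≡⟨ cong (λ t → a ^ k * (a ^ k * t)) (^-distrib-* q q k) ⟨
      a ^ k * (a ^ k * (q * q) ^ k)       ≡⟨ cong (a ^ k *_) (^-distrib-* a (q * q) k) ⟨
      a ^ k * (a * (q * q)) ^ k           ≡⟨ ^-distrib-* a (a * (q * q)) k ⟨
      1ℚ ^ k                              ≡⟨ 1^ k ⟩
      1ℚ                                  ∎
    lemma : ∀ a c x q → (a * c) * ((a * c) * 1ℚ) * ((x * x) * (q * q)) ≡ a * (a * (q * q)) * (c * (c * 1ℚ) * (x * x))
    lemma = solve-∀ ℚ-ring
    simplify : (a ^ k * c) ^ 2 * (x * q) ^ (2 ℕ.* k) ≡ c ^ 2 * x ^ (2 ℕ.* k)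
    simplify = begin
      (a ^ k * c) ^ 2 * (x * q) ^ (2 ℕ.* k)
        ≡⟨ cong ((a ^ k * c) ^ 2 *_) (trans (^-distrib-* x q (2 ℕ.* k)) (cong₂ _*_ (^2* x k) (^2* q k))) ⟩
      (a ^ k * c) ^ 2 * ((x ^ k * x ^ k) * (q ^ k * q ^ k))
        ≡⟨ lemma (a ^ k) c (x ^ k) (q ^ k) ⟩
      a ^ k * (a ^ k * (q ^ k * q ^ k)) * (c ^ 2 * (x ^ k * x ^ k))
        ≡⟨ cong₂ (λ s t → s * (c ^ 2 * t)) aq≡1 (sym (^2* x k)) ⟩
      1ℚ * (c ^ 2 * x ^ (2 ℕ.* k))
        ≡⟨ ℚ.*-identityˡ (c ^ 2 * x ^ (2 ℕ.* k)) ⟩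
      c ^ 2 * x ^ (2 ℕ.* k) ∎

  -- With m = h - k and l = h - 2k, the halves come from the normalisation (h of them) and from the
  -- argument w/2 (l of them). As h + l = 2m, they turn (-4)ᵐ into (-1)ᵐ. Together with the
  -- alternating sign this is (-1)ᵐ⁺ᵏ = (-1)ʰ, independent of k, so it can leave the sum.
  legendreP-term≡ : ∀ {w} → w ∈ℤ₍ p ₎ → ∀ {k} → 2 ℕ.* k ℕ.≤ h →
    ½ ^ h * (legendreCoeff h k * (w * ½) ^ (h ℕ.∸ 2 ℕ.* k)) ≡
    fromℤ -1ℤ ^ h * (fromℕ (h C k) * (fromℕ ((h ℕ.∸ k) C (h ℕ.∸ 2 ℕ.* k)) * w ^ (h ℕ.∸ 2 ℕ.* k))) [mod p ]
  legendreP-term≡ {w} w∈ {k} 2k≤h = subst₂ (_≡_[mod p ]) (sym before) after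
    (*-cong-mod (centralBinomial≡ (ℕ.m∸n≤m h k)) (≡mod-refl rest∈))
    where
    open ≡-Reasoning
    m = h ℕ.∸ k
    l = h ℕ.∸ 2 ℕ.* k
    D = (2 ℕ.* m) C m
    c = m C l
    s = fromℤ -1ℤ
    k≤h : k ℕ.≤ h
    k≤h = ℕ.≤-trans (ℕ.m≤m+n k (k ℕ.+ 0)) 2k≤h
    m+k≡h : m ℕ.+ k ≡ h
    m+k≡h = ℕ.m∸n+n≡m k≤h
    h+l≡2m : h ℕ.+ l ≡ 2 ℕ.* m
    h+l≡2m = begin
      h ℕ.+ l                    ≡⟨ cong₂ ℕ._+_ (sym m+k≡h) (n∸2k≡[n∸k]∸k h k) ⟩
      m ℕ.+ k ℕ.+ (m ℕ.∸ k)      ≡⟨ ℕ.+-assoc m k (m ℕ.∸ k) ⟩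
      m ℕ.+ (k ℕ.+ (m ℕ.∸ k))    ≡⟨ cong (m ℕ.+_) (ℕ.m+[n∸m]≡n k≤m) ⟩
      m ℕ.+ m                    ≡⟨ cong (m ℕ.+_) (ℕ.+-identityʳ m) ⟨
      2 ℕ.* m                    ∎
      where
      k≤m : k ℕ.≤ m
      k≤m = ℕ.m+n≤o⇒m≤o∸n k (subst (ℕ._≤ h) (cong (k ℕ.+_) (ℕ.+-identityʳ k)) 2k≤h)
    rest : ℚ
    rest = s ^ k * (½ ^ h * ½ ^ l) * (fromℕ c * w ^ l)
    rest∈ : rest ∈ℤ₍ p ₎
    rest∈ = *∈ (s ^ k * (½ ^ h * ½ ^ l)) (fromℕ c * w ^ l)
      (*∈ (s ^ k) (½ ^ h * ½ ^ l) (^∈ s k (fromℤ∈ -1ℤ)) (*∈ (½ ^ h) (½ ^ l) (^∈ ½ h ½∈) (^∈ ½ l ½∈)))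
      (*∈ (fromℕ c) (w ^ l) (fromℤ∈ (+ c)) (^∈ w l w∈))
    before : ½ ^ h * (legendreCoeff h k * (w * ½) ^ l) ≡ fromℕ D * rest
    before = begin
      ½ ^ h * (legendreCoeff h k * (w * ½) ^ l)
        ≡⟨ cong₂ (λ a b → ½ ^ h * (a * b)) coeff (^-distrib-* w ½ l) ⟩
      ½ ^ h * (s ^ k * (fromℕ D * fromℕ c) * (w ^ l * ½ ^ l))
        ≡⟨ lemma (½ ^ h) (s ^ k) (fromℕ D) (fromℕ c) (w ^ l) (½ ^ l) ⟩
      fromℕ D * rest ∎
      where
      coeff : legendreCoeff h k ≡ s ^ k * (fromℕ D * fromℕ c)
      coeff = begin
        legendreCoeff h k                        ≡⟨ legendreCoeff≡ h k 2k≤h ⟩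
        fromℤ (-1ℤ ℤ.^ k ℤ.* + (D ℕ.* c))        ≡⟨ fromℤ-* (-1ℤ ℤ.^ k) (+ (D ℕ.* c)) ⟩
        fromℤ (-1ℤ ℤ.^ k) * fromℕ (D ℕ.* c)      ≡⟨ cong₂ _*_ (fromℤ-^ -1ℤ k) (trans (cong fromℤ (ℤ.pos-* D c)) (fromℤ-* (+ D) (+ c))) ⟩
        s ^ k * (fromℕ D * fromℕ c)              ∎
      lemma : ∀ u s D c w v → u * (s * (D * c) * (w * v)) ≡ D * (s * (u * v) * (c * w))
      lemma = solve-∀ ℚ-ring
    signs : fromℤ -4ℤ ^ m * (½ ^ h * ½ ^ l) ≡ s ^ m
    signs = begin
      fromℤ -4ℤ ^ m * (½ ^ h * ½ ^ l)       ≡⟨ cong (fromℤ -4ℤ ^ m *_) (^-homo-* ½ h l) ⟨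
      fromℤ -4ℤ ^ m * ½ ^ (h ℕ.+ l)         ≡⟨ cong (λ e → fromℤ -4ℤ ^ m * ½ ^ e) h+l≡2m ⟩
      fromℤ -4ℤ ^ m * ½ ^ (2 ℕ.* m)         ≡⟨ cong (fromℤ -4ℤ ^ m *_) (^-assocʳ ½ 2 m) ⟨
      fromℤ -4ℤ ^ m * (½ ^ 2) ^ m           ≡⟨ ^-distrib-* (fromℤ -4ℤ) (½ ^ 2) m ⟨
      s ^ m                                 ∎
    after : fromℤ -4ℤ ^ m * fromℕ (h C m) * rest ≡ s ^ h * (fromℕ (h C k) * (fromℕ c * w ^ l))
    after = begin
      fromℤ -4ℤ ^ m * fromℕ (h C m) * rest
        ≡⟨ lemma (fromℤ -4ℤ ^ m) (fromℕ (h C m)) (s ^ k) (½ ^ h * ½ ^ l) (fromℕ c * w ^ l) ⟩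
      (fromℤ -4ℤ ^ m * (½ ^ h * ½ ^ l)) * s ^ k * (fromℕ (h C m) * (fromℕ c * w ^ l))
        ≡⟨ cong₂ (λ a b → a * s ^ k * (fromℕ b * (fromℕ c * w ^ l))) signs (sym (nCk≡nC[n∸k] k≤h)) ⟩
      s ^ m * s ^ k * (fromℕ (h C k) * (fromℕ c * w ^ l))
        ≡⟨ cong (_* (fromℕ (h C k) * (fromℕ c * w ^ l))) (trans (sym (^-homo-* s m k)) (cong (s ^_) m+k≡h)) ⟩
      s ^ h * (fromℕ (h C k) * (fromℕ c * w ^ l)) ∎
      where
      lemma : ∀ f b s u r → f * b * (s * u * r) ≡ (f * u) * s * (b * r)
      lemma = solve-∀ ℚ-ring

  centralBinomialSum≡ : ∀ {x} → x ∈ℤ₍ p ₎ →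
    ∑[ k < suc h ] (fromℕ ((2 ℕ.* toℕ k) C toℕ k) ^ 2 * (x * (+ 1 / 4)) ^ (2 ℕ.* toℕ k)) ≡
    ∑[ k < suc h ] (fromℕ (h C toℕ k) ^ 2 * x ^ (2 ℕ.* toℕ k)) [mod p ]
  centralBinomialSum≡ {x} x∈ = sum-cong-mod (suc h) λ k → sum-term≡ {x} x∈ {toℕ k} (ℕ.≤-pred (Fin.toℕ<n k))

  legendreP≡ : ∀ {x y} → x * y ≡ 1ℚ → x ∈ℤ₍ p ₎ → y ∈ℤ₍ p ₎ →
    legendreP h ((x + y) * ½) ≡
    fromℤ -1ℤ ^ h * binomialSum h (λ j → x ^ j * (fromℕ (h C (h ℕ.∸ j)) * y ^ (h ℕ.∸ j))) [mod p ]
  legendreP≡ {x} {y} xy≡1 x∈ y∈ = subst₂ (_≡_[mod p ])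
    (sym (*-distribˡ-sum {suc (h ℕ./ 2)} (½ ^ h) (λ k → legendreCoeff h (toℕ k) * ((x + y) * ½) ^ (h ℕ.∸ 2 ℕ.* toℕ k))))
    (trans
      (sym (*-distribˡ-sum {suc (h ℕ./ 2)} (fromℤ -1ℤ ^ h) λ k →
        fromℕ (h C toℕ k) * (fromℕ ((h ℕ.∸ toℕ k) C (h ℕ.∸ 2 ℕ.* toℕ k)) * (x + y) ^ (h ℕ.∸ 2 ℕ.* toℕ k))))
      (cong (fromℤ -1ℤ ^ h *_) (centralTrinomial h x y xy≡1)))
    (sum-cong-mod (suc (h ℕ./ 2)) λ k →
      legendreP-term≡ {x + y} (+∈ x y x∈ y∈) {toℕ k} (m≤n/2⇒2m≤n (ℕ.≤-pred (Fin.toℕ<n k))))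

  -- The argument holds for any representative congruent to a, so the pair returned by `residue` is
  -- abstracted and its computation is never unfolded.
  legendreSymbol≡ : ∀ a (a∈ : a ∈ℤ₍ p ₎) → fromℤ (legendreSymbol p-prime a a∈) ≡ a ^ h [mod p ]
  legendreSymbol≡ a a∈ = from-residue (residue p-prime a a∈)
    where
    from-residue : (ρ : Σ[ r ∈ Fin p ] a ≡ fromℕ (toℕ r) [mod p ]) → fromℤ (legendre (proj₁ ρ)) ≡ a ^ h [mod p ]
    from-residue (r , a≡r) = ≡mod-trans
      (subst (fromℤ (legendre r) ≡_[mod p ]) (fromℤ-^ (+ toℕ r) h)
        (fromℤ-cong-mod {i = legendre r} {(+ toℕ r) ℤ.^ h} (euler-criterion p-prime {h} p≡1+2h r)))
      (^-cong-mod h (≡mod-sym a≡r))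

  -- The inverse of x is an arbitrary y with xy = 1, which keeps the nonzero instance of `1/_` out
  -- of the computation.
  centralBinomialSum≡legendreP : ∀ {x y} → x * y ≡ 1ℚ → (x∈ : x ∈ℤ₍ p ₎) → y ∈ℤ₍ p ₎ →
    ∑[ k < suc h ] (fromℕ ((2 ℕ.* toℕ k) C toℕ k) ^ 2 * (x * (+ 1 / 4)) ^ (2 ℕ.* toℕ k)) ≡
    fromℤ (legendreSymbol p-prime (- x) (neg∈ x x∈)) * legendreP h ((x + y) * ½) [mod p ]
  centralBinomialSum≡legendreP {x} {y} xy≡1 x∈ y∈ = ≡mod-trans (centralBinomialSum≡ {x} x∈)
    (≡mod-sym (subst (rhs ≡_[mod p ]) rhs≡
      (*-cong-mod (legendreSymbol≡ (- x) (neg∈ x x∈)) (legendreP≡ {x} {y} xy≡1 x∈ y∈))))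
    where
    open ≡-Reasoning
    rhs : ℚ
    rhs = fromℤ (legendreSymbol p-prime (- x) (neg∈ x x∈)) * legendreP h ((x + y) * ½)
    f : ℕ → ℚ
    f j = x ^ j * (fromℕ (h C (h ℕ.∸ j)) * y ^ (h ℕ.∸ j))
    lemma : ∀ a → - a * (- 1ℚ) ≡ a
    lemma = solve-∀ ℚ-ring
    rearrange : ∀ u c v d w → u * (c * (v * (d * w))) ≡ c * d * v * (u * w)
    rearrange = solve-∀ ℚ-ring
    finish : ∀ c v → c * c * v * v ≡ c * (c * 1ℚ) * (v * v)
    finish = solve-∀ ℚ-ring
    -- The factor xʰ from Euler's criterion absorbs the power of y and leaves a second xʲ, whence
    -- the exponent 2j.
    cancel : ∀ {j} → j ℕ.≤ h → x ^ h * y ^ (h ℕ.∸ j) ≡ x ^ j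
    cancel {j} j≤h = begin
      x ^ h * y ^ (h ℕ.∸ j)                          ≡⟨ cong (λ e → x ^ e * y ^ (h ℕ.∸ j)) (ℕ.m+[n∸m]≡n j≤h) ⟨
      x ^ (j ℕ.+ (h ℕ.∸ j)) * y ^ (h ℕ.∸ j)          ≡⟨ cong (_* y ^ (h ℕ.∸ j)) (^-homo-* x j (h ℕ.∸ j)) ⟩
      x ^ j * x ^ (h ℕ.∸ j) * y ^ (h ℕ.∸ j)          ≡⟨ ℚ.*-assoc (x ^ j) (x ^ (h ℕ.∸ j)) (y ^ (h ℕ.∸ j)) ⟩
      x ^ j * (x ^ (h ℕ.∸ j) * y ^ (h ℕ.∸ j))        ≡⟨ cong (x ^ j *_) (^-distrib-* x y (h ℕ.∸ j)) ⟨
      x ^ j * (x * y) ^ (h ℕ.∸ j)                    ≡⟨ cong (λ t → x ^ j * t ^ (h ℕ.∸ j)) xy≡1 ⟩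
      x ^ j * 1ℚ ^ (h ℕ.∸ j)                         ≡⟨ cong (x ^ j *_) (1^ (h ℕ.∸ j)) ⟩
      x ^ j * 1ℚ                                     ≡⟨ ℚ.*-identityʳ (x ^ j) ⟩
      x ^ j                                          ∎
    term≡ : ∀ {j} → j ℕ.< suc h → x ^ h * (fromℕ (h C j) * f j) ≡ fromℕ (h C j) ^ 2 * x ^ (2 ℕ.* j)
    term≡ {j} (s≤s j≤h) = begin
      x ^ h * (fromℕ (h C j) * f j)
        ≡⟨ rearrange (x ^ h) (fromℕ (h C j)) (x ^ j) (fromℕ (h C (h ℕ.∸ j))) (y ^ (h ℕ.∸ j)) ⟩
      fromℕ (h C j) * fromℕ (h C (h ℕ.∸ j)) * x ^ j * (x ^ h * y ^ (h ℕ.∸ j))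
        ≡⟨ cong₂ (λ c t → fromℕ (h C j) * fromℕ c * x ^ j * t) (sym (nCk≡nC[n∸k] j≤h)) (cancel j≤h) ⟩
      fromℕ (h C j) * fromℕ (h C j) * x ^ j * x ^ j
        ≡⟨ finish (fromℕ (h C j)) (x ^ j) ⟩
      fromℕ (h C j) ^ 2 * (x ^ j * x ^ j)
        ≡⟨ cong (fromℕ (h C j) ^ 2 *_) (^2* x j) ⟨
      fromℕ (h C j) ^ 2 * x ^ (2 ℕ.* j) ∎
    rhs≡ : (- x) ^ h * (fromℤ -1ℤ ^ h * binomialSum h f) ≡ ∑[ k < suc h ] (fromℕ (h C toℕ k) ^ 2 * x ^ (2 ℕ.* toℕ k))
    rhs≡ = begin
      (- x) ^ h * (fromℤ -1ℤ ^ h * binomialSum h f)       ≡⟨ ℚ.*-assoc ((- x) ^ h) (fromℤ -1ℤ ^ h) (binomialSum h f) ⟨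
      -- One (-1)ʰ comes from the Legendre symbol of -x, the other from the Legendre polynomial;
      -- they cancel.
      (- x) ^ h * fromℤ -1ℤ ^ h * binomialSum h f         ≡⟨ cong (_* binomialSum h f) (^-distrib-* (- x) (fromℤ -1ℤ) h) ⟨
      (- x * fromℤ -1ℤ) ^ h * binomialSum h f             ≡⟨ cong (λ t → t ^ h * binomialSum h f) (lemma x) ⟩
      x ^ h * binomialSum h f                             ≡⟨ *-distribˡ-sum {suc h} (x ^ h) (λ k → fromℕ (h C toℕ k) * f (toℕ k)) ⟩
      ∑[ k < suc h ] (x ^ h * (fromℕ (h C toℕ k) * f (toℕ k)))
        ≡⟨ sum-cong-< (suc h) {λ j → x ^ h * (fromℕ (h C j) * f j)} term≡ ⟩
      ∑[ k < suc h ] (fromℕ (h C toℕ k) ^ 2 * x ^ (2 ℕ.* toℕ k)) ∎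

odd⇒≡1+2[n/2] : ∀ n → ¬ 2 ∣ n → n ≡ suc (2 ℕ.* ((n ℕ.∸ 1) ℕ./ 2))
odd⇒≡1+2[n/2] zero    2∤n = contradiction (2 ℕ∣.∣0) 2∤n
odd⇒≡1+2[n/2] (suc n) 2∤1+n = cong suc (sym (trans (ℕ.*-comm 2 (n ℕ./ 2)) (ℕ.m/n*n≡m (2∣n n 2∤1+n))))
  where
  2∣n : ∀ n → ¬ 2 ∣ suc n → 2 ∣ n
  2∣n zero          _     = 2 ℕ∣.∣0
  2∣n (suc zero)    2∤2   = contradiction ℕ∣.∣-refl 2∤2
  2∣n (suc (suc n)) 2∤3+n = ℕ∣.∣m∣n⇒∣m+n (ℕ∣.∣-refl {2}) (2∣n n (λ 2∣1+n → 2∤3+n (ℕ∣.∣m∣n⇒∣m+n (ℕ∣.∣-refl {2}) 2∣1+n)))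

theorem2p8 : (p : ℕ) (p-prime : Prime p) → ¬ (2 ∣ p) →
    (x : ℚ) (x∈ : x ∈ℤ₍ p ₎) (x≢0 : ¬ (x ≡ 0ℚ [mod p ])) →
    (∑[ k < suc ((p ℕ.∸ 1) ℕ./ 2) ] (fromℕ ((2 ℕ.* toℕ k) C toℕ k) ^ 2 * (x * (+ 1 / 4)) ^ (2 ℕ.* toℕ k)))
    ≡ fromℤ (legendreSymbol p-prime (- x) (neg∈ x x∈)) * legendreP ((p ℕ.∸ 1) ℕ./ 2) ((x + (1/ x) {{≢0⇒nonZero x≢0}}) * ½)
    [mod p ]
-- Nonvanishing modulo p acts twice: it makes x invertible in ℚ, and it keeps the inverse in ℤ₍ p ₎.
theorem2p8 p p-prime 2∤p x x∈ x≢0 = centralBinomialSum≡legendreP {h = (p ℕ.∸ 1) ℕ./ 2} p-prime (odd⇒≡1+2[n/2] p 2∤p) {x} {(1/ x) {{x-nonZero}}}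
  (ℚ.*-inverseʳ x {{x-nonZero}}) x∈ (1/∈-≢0 x {{x-nonZero}} p-prime x∈ x≢0)
  where
  x-nonZero = ≢0⇒nonZero x≢0
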